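{- Let $\mathbf{T}$ be a tree chosen uniformly at random from the $n^{n-2}$ labelled trees on vertex set $\{1,\ldots,n\}$, and for $0\le k\le n$ let $X_k$ be the number of independent sets of size $k$ in $\mathbf{T}$. Then asymptotically almost surely (i.e., with probability tending to $1$ as $n\to\infty$) the sequence $(X_\ell, X_{\ell+1},\ldots,X_n)$ is weakly decreasing, where $\ell=0.34668n$ (i.e. $X_k\ge X_{k+1}$ for every integer $k$ with $0.34668n\le k\le n-1$).
   Context: An independent set in a graph is a set of mutually non-adjacent vertices. -}

module Defs where

open import Data.Nat using (ℕ; zero; suc; _≤_; _*_; _^_; _∸_)
open import Data.Bool using (Bool; true; false)
open import Data.Fin using (Fin)
open import Data.Fin.Subset using (Subset; _∈_; ∣_∣)
open import Data.Fin.Subset.Properties using (_∈?_)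
open import Data.Fin.Properties using (all?)
open import Data.Vec using (Vec; []; _∷_; lookup)
open import Data.List using (List; []; _∷_; length; filter; map; concatMap; _++_)
open import Data.List.Relation.Unary.All using (All)
open import Data.List.Relation.Unary.Unique.Propositional using (Unique)
open import Data.Product using (_×_; ∃)
open import Relation.Nullary using (¬_; Dec; yes; no)
open import Relation.Nullary.Decidable using (_×-dec_; _→-dec_; ¬?)
open import Relation.Binary.PropositionalEquality using (_≡_)
import Data.Bool.Properties as BoolP
import Data.Nat as ℕ

lastOf : {A : Set} → A → List A → A
lastOf v [] = v
lastOf v (w ∷ ws) = lastOf w ws

Adj : ℕ → Set
Adj n = Vec (Vec Bool n) n

module _ {n : ℕ} (A : Adj n) where

  _~_ : Fin n → Fin n → Set
  i ~ j = lookup (lookup A i) j ≡ true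

  IsSimple : Set
  IsSimple = (∀ i → ¬ (i ~ i)) × (∀ i j → i ~ j → j ~ i)

  data Reach : Fin n → Fin n → Set where
    here : ∀ {i} → Reach i i
    step : ∀ {i j k} → i ~ j → Reach j k → Reach i k

  IsConnected : Set
  IsConnected = ∀ i j → Reach i j

  data Path : List (Fin n) → Set where
    one  : ∀ {v} → Path (v ∷ [])
    cons : ∀ {u v vs} → u ~ v → Path (v ∷ vs) → Path (u ∷ v ∷ vs)

  data IsCycle : List (Fin n) → Set where
    cyc : ∀ {v₀ v₁ v₂ vs} →
          Unique (v₀ ∷ v₁ ∷ v₂ ∷ vs) →
          Path (v₀ ∷ v₁ ∷ v₂ ∷ vs) →
          lastOf v₂ vs ~ v₀ →
          IsCycle (v₀ ∷ v₁ ∷ v₂ ∷ vs)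

  IsAcyclic : Set
  IsAcyclic = ∀ cs → ¬ IsCycle cs

  IsTree : Set
  IsTree = IsSimple × IsConnected × IsAcyclic

  IsIndependent : Subset n → Set
  IsIndependent S = ∀ i j → i ∈ S → j ∈ S → ¬ (i ~ j)

  isIndependent? : (S : Subset n) → Dec (IsIndependent S)
  isIndependent? S =
    all? λ i → all? λ j →
      (i ∈? S) →-dec ((j ∈? S) →-dec (¬? (lookup (lookup A i) j BoolP.≟ true)))

allSubsets : (n : ℕ) → List (Subset n)
allSubsets zero = [] ∷ []
allSubsets (suc n) = map (true ∷_) (allSubsets n) ++ map (false ∷_) (allSubsets n)

X : {n : ℕ} → Adj n → ℕ → ℕ
X A k = length (filter (λ S → isIndependent? A S ×-dec (∣ S ∣ ℕ.≟ k)) (allSubsets _))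

TailDecreasing : {n : ℕ} → Adj n → Set
TailDecreasing {n} A =
  ∀ k → 34668 * n ≤ 100000 * k → suc k ≤ n → X A (suc k) ≤ X A k

{-# OPTIONS --safe #-}

-- Double counting the pairs I ⊂ J of independent sets of sizes k and k + 1 shows that X_{k+1} > X_k forces
-- more than X_k / n independent k-sets I to be "heavy": at least k + 1 vertices lie outside I and have no
-- neighbour in I.  Among all forests on n vertices the path minimises X_k, so there are at least
-- C(n+1-k,k) / n heavy sets.  Each heavy I gives C(k+1,j) pairs (I , J) with |J| = j, J disjoint from I
-- and no edge between I and J.  For fixed (I , J) with c = n - k - j, a tree in which I is independent and
-- no edge joins I to J is determined by a choice, for each vertex, of one neighbour ("parent"), so there are
-- at most c^k (n-k)^j n^c of them, and Markov's inequality bounds the number of exceptional trees.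
-- Up to polynomial factors this bound is n^n ρ^n with ρ depending on k/n and j/n.  The range of k/n is cut
-- into finitely many cells on each of which j/n is constant; ρ < 1 is an inequality between explicit integers.
module Submission where

open import Defs
open import Data.Bool using (Bool; true; false; not; _∨_; T)
import Data.Bool.Properties as Bool
open import Data.Empty using (⊥-elim)
open import Data.Fin using (Fin; zero; suc)
import Data.Fin as Fin
open import Data.Fin.Properties using (any?; all?)
open import Data.Fin.Subset using (Subset; ∣_∣; ⊤; ⊥; ∁)
open import Data.Fin.Subset.Properties using (∣⊤∣≡n; ∣⊥∣≡0; ∉⊥; ∈⊤; ∣p∣≤n; ∣∁p∣≡n∸∣p∣)
open import Data.List using (List; []; _∷_; length; filter; map; _++_; allFin; upTo; cartesianProductWith)
open import Data.List.Properties using (map-tabulate; length-++; length-map; length-tabulate; length-upTo)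
import Data.List.Membership.DecPropositional as DecMembership
import Data.List.Membership.Propositional as List
open import Data.List.Membership.Propositional.Properties
  using (∈-∃++; ∈-++⁺ˡ; ∈-++⁺ʳ; ∈-++⁻; ∈-allFin; ∈-upTo⁺; ∈-map⁺; ∈-cartesianProductWith⁺)
open import Data.List.Relation.Unary.All using (All; []; _∷_)
import Data.List.Relation.Unary.All as All
import Data.List.Relation.Unary.All.Properties as All
open import Data.List.Relation.Unary.AllPairs using ([]; _∷_)
open import Data.List.Relation.Unary.Any using (here; there)
open import Data.List.Relation.Unary.Unique.Propositional using (Unique)
import Data.List.Relation.Unary.Unique.Propositional.Properties as Unique
open import Data.Nat
open import Data.Nat.DivMod
open import Data.Nat.Properties
open import Data.Nat.Tactic.RingSolver using (solve-∀)
open import Data.Product using (_×_; _,_; proj₁; proj₂; ∃; Σ)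
open import Data.Sum using (_⊎_; inj₁; inj₂)
open import Data.Unit using (tt)
open import Data.Vec using (Vec; []; _∷_; lookup; tabulate; updateAt; zipWith)
open import Data.Vec.Properties
  using (lookup∘updateAt; lookup∘updateAt′; lookup∘tabulate; lookup-zipWith; lookup-map; tabulate∘lookup; tabulate-cong;
         []=⇒lookup; lookup⇒[]=)
open import Function using (_∘_; id)
open import Relation.Binary.PropositionalEquality
open import Relation.Nullary
open import Relation.Nullary.Decidable using (_×-dec_; _→-dec_; ¬?; decidable-stable; dec-true)
open import Relation.Unary using (Decidable)

-- Heavy sets are counted through subsets J of their free vertices because a fixed pair (I , J)
-- restricts the parents in a fixed pattern, while the factor C(k+1,j) repays the choice of J. The
-- size j is a free parameter and has to be tuned: with j = k + 1 the rate ρ would exceed 1 at k/n =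
-- 0.34668, and j near 0.218 n brings it just below 1. The lower bound on X_k holds in every forest,
-- so no concentration of X_k is needed and a first moment suffices. Parent functions overcount,
-- since without restrictions there are n^n of them against n^(n-2) trees; this n² and the other
-- polynomial losses are harmless because ρ < 1 strictly. Everything stays in the natural numbers:
-- entropies appear as powers x^x, and denominators are cleared.

private variable
  A B C D P Q : Set

-- Binomial coefficients and exponential estimates

-- binom s t is the binomial coefficient C(s+t, s).
binom : ℕ → ℕ → ℕ
binom zero    t       = 1
binom (suc s) zero    = 1
binom (suc s) (suc t) = binom s (suc t) + binom (suc s) t

binom-zeroʳ : ∀ s → binom s 0 ≡ 1
binom-zeroʳ zero    = refl
binom-zeroʳ (suc s) = refl

binom-comm : ∀ s t → binom s t ≡ binom t s
binom-comm zero    zero    = refl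
binom-comm zero    (suc t) = refl
binom-comm (suc s) zero    = refl
binom-comm (suc s) (suc t) =
  trans (cong₂ _+_ (binom-comm s (suc t)) (binom-comm (suc s) t))
        (+-comm (binom (suc t) s) (binom t (suc s)))

binom-≤-sucʳ : ∀ s t → binom s t ≤ binom s (suc t)
binom-≤-sucʳ zero    t = ≤-refl
binom-≤-sucʳ (suc s) t = m≤n+m (binom (suc s) t) (binom s (suc t))

binom-monoʳ : ∀ s {t u} → t ≤ u → binom s t ≤ binom s u
binom-monoʳ s t≤u = go (≤⇒≤′ t≤u)
  where
  go : ∀ {t u} → t ≤′ u → binom s t ≤ binom s u
  go ≤′-refl               = ≤-refl
  go (≤′-step {u} p)       = ≤-trans (go p) (binom-≤-sucʳ s u)

binom-mono : ∀ {s s′ t t′} → s ≤ s′ → t ≤ t′ → binom s t ≤ binom s′ t′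
binom-mono {s} {s′} {t} {t′} p q = begin
  binom s t    ≤⟨ binom-monoʳ s q ⟩
  binom s t′   ≡⟨ binom-comm s t′ ⟩
  binom t′ s   ≤⟨ binom-monoʳ t′ p ⟩
  binom t′ s′  ≡⟨ binom-comm t′ s′ ⟩
  binom s′ t′  ∎
  where open ≤-Reasoning

-- Both sides are (s+t+1)! / (s! t!). This gives the ratio of neighbouring terms of a binomial
-- expansion.
binom-absorb : ∀ s t → binom (suc s) t * suc s ≡ binom s (suc t) * suc t
binom-absorb zero zero    = refl
binom-absorb zero (suc t) = cong (λ z → suc z) (begin
    (binom 1 t) * 1    ≡⟨ binom-absorb zero t ⟩
    1 * suc t          ≡⟨ *-identityˡ (suc t) ⟩
    suc t              ≡⟨ sym (*-identityˡ (suc t)) ⟩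
    1 * suc t ∎)
  where open ≡-Reasoning
binom-absorb (suc s) zero = begin
    1 * suc (suc s)                     ≡⟨ lem (suc s) ⟩
    1 * suc s * 1 + 1                   ≡⟨ cong (λ z → z * 1 + 1) (binom-absorb s zero) ⟩
    binom s 1 * 1 * 1 + 1               ≡⟨ lem′ (binom s 1) ⟩
    (binom s 1 + 1) * 1 ∎
  where
  open ≡-Reasoning
  lem : ∀ x → 1 * suc x ≡ 1 * x * 1 + 1
  lem = solve-∀
  lem′ : ∀ x → x * 1 * 1 + 1 ≡ (x + 1) * 1
  lem′ = solve-∀
binom-absorb (suc s) (suc t) = begin
    (binom (suc s) (suc t) + binom (suc (suc s)) t) * suc (suc s)
      ≡⟨ *-distribʳ-+ (suc (suc s)) (binom (suc s) (suc t)) (binom (suc (suc s)) t) ⟩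
    x * suc (suc s) + binom (suc (suc s)) t * suc (suc s)
      ≡⟨ cong (x * suc (suc s) +_) (binom-absorb (suc s) t) ⟩
    x * suc (suc s) + x * suc t
      ≡⟨ lem x s t ⟩
    x * suc s + x * suc (suc t)
      ≡⟨ cong (_+ x * suc (suc t)) (binom-absorb s (suc t)) ⟩
    binom s (suc (suc t)) * suc (suc t) + x * suc (suc t)
      ≡⟨ sym (*-distribʳ-+ (suc (suc t)) (binom s (suc (suc t))) x) ⟩
    (binom s (suc (suc t)) + x) * suc (suc t) ∎
  where
  open ≡-Reasoning
  x = binom (suc s) (suc t)
  lem : ∀ x s t → x * suc (suc s) + x * suc t ≡ x * suc s + x * suc (suc t)
  lem = solve-∀

-- The sum runs from (i , l) to (i + l , 0) at constant i + l. Carrying both indices avoids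
-- truncated subtraction.
antidiag : (ℕ → ℕ → ℕ) → ℕ → ℕ → ℕ
antidiag f i zero    = f i zero
antidiag f i (suc l) = f i (suc l) + antidiag f (suc i) l

antidiag-≤ : ∀ f M i l → (∀ i′ l′ → i′ + l′ ≡ i + l → f i′ l′ ≤ M) → antidiag f i l ≤ suc l * M
antidiag-≤ f M i zero    h = ≤-trans (h i 0 refl) (m≤m+n M 0)
antidiag-≤ f M i (suc l) h = +-mono-≤ (h i (suc l) refl)
  (antidiag-≤ f M (suc i) l (λ i′ l′ e → h i′ l′ (trans e (sym (+-suc i l)))))

term : ℕ → ℕ → ℕ → ℕ → ℕ
term x y i l = binom i l * (x ^ i * y ^ l)

term-comm : ∀ x y i l → term x y i l ≡ term y x l i
term-comm x y i l = cong₂ _*_ (binom-comm i l) (*-comm (x ^ i) (y ^ l))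

term-pascal : ∀ x y i l → term x y (suc i) (suc l) ≡ x * term x y i (suc l) + y * term x y (suc i) l
term-pascal x y i l = lem x y (binom i (suc l)) (binom (suc i) l) (x ^ i) (y ^ l)
  where
  lem : ∀ x y b c p q → (b + c) * (x * p * (y * q)) ≡ x * (b * (p * (y * q))) + y * (c * (x * p * q))
  lem = solve-∀

-- Pascal's rule produces x times every old term, but y times all of them except the first; the
-- extra summand on the left restores that one.
antidiag-term : ∀ x y i l →
  antidiag (term x y) (suc i) l + y * term x y i l ≡ (x + y) * antidiag (term x y) i l
antidiag-term x y i zero = trans (cong (λ b → 1 * (x * x ^ i * 1) + y * (b * (x ^ i * 1))) (binom-zeroʳ i))
    (trans (lem x y (x ^ i)) (cong (λ b → (x + y) * (b * (x ^ i * 1))) (sym (binom-zeroʳ i))))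
  where
  lem : ∀ x y p → 1 * (x * p * 1) + y * (1 * (p * 1)) ≡ (x + y) * (1 * (p * 1))
  lem = solve-∀
antidiag-term x y i (suc l) = begin
  (term x y (suc i) (suc l) + A₂) + y * t₀
    ≡⟨ cong (λ z → (z + A₂) + y * t₀) (term-pascal x y i l) ⟩
  ((x * t₀ + y * t₁) + A₂) + y * t₀
    ≡⟨ lem x y t₀ t₁ A₂ ⟩
  (x + y) * t₀ + (A₂ + y * t₁)
    ≡⟨ cong ((x + y) * t₀ +_) (antidiag-term x y (suc i) l) ⟩
  (x + y) * t₀ + (x + y) * antidiag (term x y) (suc i) l
    ≡⟨ *-distribˡ-+ (x + y) t₀ _ ⟨
  (x + y) * (t₀ + antidiag (term x y) (suc i) l) ∎
  where
  open ≡-Reasoning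
  A₂ = antidiag (term x y) (suc (suc i)) l
  t₀ = term x y i (suc l)
  t₁ = term x y (suc i) l
  lem : ∀ x y t₀ t₁ A → ((x * t₀ + y * t₁) + A) + y * t₀ ≡ (x + y) * t₀ + (A + y * t₁)
  lem = solve-∀

binomial-theorem : ∀ x y N → antidiag (term x y) 0 N ≡ (x + y) ^ N
binomial-theorem x y zero    = refl
binomial-theorem x y (suc N) = begin
  term x y 0 (suc N) + antidiag (term x y) 1 N      ≡⟨ cong (_+ antidiag (term x y) 1 N) (lem y (y ^ N)) ⟩
  y * term x y 0 N + antidiag (term x y) 1 N        ≡⟨ +-comm (y * term x y 0 N) _ ⟩
  antidiag (term x y) 1 N + y * term x y 0 N        ≡⟨ antidiag-term x y 0 N ⟩
  (x + y) * antidiag (term x y) 0 N                 ≡⟨ cong ((x + y) *_) (binomial-theorem x y N) ⟩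
  (x + y) * (x + y) ^ N                             ∎
  where
  open ≡-Reasoning
  lem : ∀ y p → 1 * (1 * (y * p)) ≡ y * (1 * (1 * p))
  lem = solve-∀

term-step : ∀ s t i l → s ≤ suc i → suc l ≤ t → term s t (suc i) l ≤ term s t i (suc l)
term-step s t i l s≤ l< = begin
  binom (suc i) l * (s * s ^ i * t ^ l)       ≡⟨ lem (binom (suc i) l) s (s ^ i) (t ^ l) ⟩
  binom (suc i) l * s * (s ^ i * t ^ l)       ≤⟨ *-monoˡ-≤ (s ^ i * t ^ l) ratio ⟩
  binom i (suc l) * t * (s ^ i * t ^ l)       ≡⟨ lem′ (binom i (suc l)) t (s ^ i) (t ^ l) ⟩
  binom i (suc l) * (s ^ i * (t * t ^ l))     ∎
  where
  open ≤-Reasoning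
  ratio : binom (suc i) l * s ≤ binom i (suc l) * t
  ratio = begin
    binom (suc i) l * s      ≤⟨ *-monoʳ-≤ (binom (suc i) l) s≤ ⟩
    binom (suc i) l * suc i  ≡⟨ binom-absorb i l ⟩
    binom i (suc l) * suc l  ≤⟨ *-monoʳ-≤ (binom i (suc l)) l< ⟩
    binom i (suc l) * t      ∎
  lem : ∀ b s p q → b * (s * p * q) ≡ b * s * (p * q)
  lem = solve-∀
  lem′ : ∀ b t p q → b * t * (p * q) ≡ b * (p * (t * q))
  lem′ = solve-∀

term-unimodal : ∀ s t d l → d + l ≤ t → term s t (d + s) l ≤ term s t s (d + l)
term-unimodal s t zero    l h = ≤-refl
term-unimodal s t (suc d) l h = ≤-trans
  (term-step s t (d + s) l (≤-trans (m≤n+m s d) (n≤1+n (d + s))) (≤-trans (s≤s (m≤n+m l d)) h))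
  (≤-trans (term-unimodal s t d (suc l) (≤-trans (≤-reflexive (+-suc d l)) h))
           (≤-reflexive (cong (term s t s) (+-suc d l))))

-- Up to scaling, the terms of (s+t)^(s+t) form a binomial distribution with success probability
-- s/(s+t), and its mode is its mean (s , t).
term-max : ∀ s t i l → i + l ≡ s + t → term s t i l ≤ term s t s t
term-max s t i l e with ≤-total s i
... | inj₁ s≤i = subst₂ (λ i′ t′ → term s t i′ l ≤ term s t s t′) (m∸n+n≡m s≤i) eq
                   (term-unimodal s t (i ∸ s) l (≤-reflexive eq))
  where
  eq : i ∸ s + l ≡ t
  eq = +-cancelˡ-≡ s _ _ (trans (sym (+-assoc s (i ∸ s) l)) (trans (cong (_+ l) (m+[n∸m]≡n s≤i)) e))
-- The case i ≤ s is the previous one with the two coordinates exchanged.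
... | inj₂ i≤s = subst₂ _≤_ (term-comm t s l i) (term-comm t s t s)
                   (subst₂ (λ l′ s′ → term t s l′ i ≤ term t s t s′) (trans (+-comm (s ∸ i) t) eq) (m∸n+n≡m i≤s)
                     (term-unimodal t s (s ∸ i) i (≤-reflexive (m∸n+n≡m i≤s))))
  where
  eq : t + (s ∸ i) ≡ l
  eq = +-cancelˡ-≡ i _ _ (begin
    i + (t + (s ∸ i))  ≡⟨ cong (i +_) (+-comm t (s ∸ i)) ⟩
    i + (s ∸ i + t)    ≡⟨ +-assoc i (s ∸ i) t ⟨
    i + (s ∸ i) + t    ≡⟨ cong (_+ t) (m+[n∸m]≡n i≤s) ⟩
    s + t              ≡⟨ e ⟨
    i + l              ∎)
    where open ≡-Reasoning

-- The largest of the s + t + 1 terms of (s+t)^(s+t) is at least their average. This is the entropy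
-- lower bound for a binomial coefficient, with denominators cleared.
binom-entropy : ∀ s t → (s + t) ^ (s + t) ≤ suc (s + t) * (binom s t * (s ^ s * t ^ t))
binom-entropy s t = subst (_≤ suc (s + t) * term s t s t) (binomial-theorem s t (s + t))
  (antidiag-≤ (term s t) _ 0 (s + t) (term-max s t))

^-distribʳ-* : ∀ n x y → (x * y) ^ n ≡ x ^ n * y ^ n
^-distribʳ-* zero    x y = refl
^-distribʳ-* (suc n) x y = trans (cong (x * y *_) (^-distribʳ-* n x y)) (lem x y (x ^ n) (y ^ n))
  where
  lem : ∀ x y p q → x * y * (p * q) ≡ x * p * (y * q)
  lem = solve-∀

^-^-assoc : ∀ x q s → (x * q) ^ (s * q) ≡ (x ^ s) ^ q * q ^ (s * q)
^-^-assoc x q s = trans (^-distribʳ-* (s * q) x q) (cong (_* q ^ (s * q)) (sym (^-*-assoc x s q)))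

-- At (s q , t q) both sides of `binom-entropy` carry the factor q^((s+t)q). Cancelling it leaves
-- q-th powers of fixed numbers.
binom-entropy-scaled : ∀ s t q → 1 ≤ q →
  ((s + t) ^ (s + t)) ^ q ≤ suc ((s + t) * q) * (binom (s * q) (t * q) * (s ^ s * t ^ t) ^ q)
binom-entropy-scaled s t q 1≤q = *-cancelʳ-≤ _ _ (q ^ ((s + t) * q)) {{q^-nz}} (begin
  ((s + t) ^ (s + t)) ^ q * q ^ ((s + t) * q)
    ≡⟨ ^-^-assoc (s + t) q (s + t) ⟨
  ((s + t) * q) ^ ((s + t) * q)
    ≡⟨ cong (λ z → z ^ z) (*-distribʳ-+ q s t) ⟩
  (s * q + t * q) ^ (s * q + t * q)
    ≤⟨ binom-entropy (s * q) (t * q) ⟩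
  suc (s * q + t * q) * (binom (s * q) (t * q) * ((s * q) ^ (s * q) * (t * q) ^ (t * q)))
    ≡⟨ cong₂ (λ u v → suc u * (binom (s * q) (t * q) * v)) (sym (*-distribʳ-+ q s t))
             (cong₂ _*_ (^-^-assoc s q s) (^-^-assoc t q t)) ⟩
  suc ((s + t) * q) * (binom (s * q) (t * q) * ((s ^ s) ^ q * q ^ (s * q) * ((t ^ t) ^ q * q ^ (t * q))))
    ≡⟨ lem (suc ((s + t) * q)) (binom (s * q) (t * q)) ((s ^ s) ^ q) (q ^ (s * q)) ((t ^ t) ^ q) (q ^ (t * q)) ⟩
  suc ((s + t) * q) * (binom (s * q) (t * q) * ((s ^ s) ^ q * (t ^ t) ^ q)) * (q ^ (s * q) * q ^ (t * q))
    ≡⟨ cong₂ (λ u v → suc ((s + t) * q) * (binom (s * q) (t * q) * u) * v)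
             (sym (^-distribʳ-* q (s ^ s) (t ^ t)))
             (trans (sym (^-distribˡ-+-* q (s * q) (t * q))) (cong (q ^_) (sym (*-distribʳ-+ q s t)))) ⟩
  suc ((s + t) * q) * (binom (s * q) (t * q) * (s ^ s * t ^ t) ^ q) * q ^ ((s + t) * q) ∎)
  where
  open ≤-Reasoning
  q^-nz : NonZero (q ^ ((s + t) * q))
  q^-nz = m^n≢0 q ((s + t) * q) {{>-nonZero 1≤q}}
  lem : ∀ a b p x r y → a * (b * (p * x * (r * y))) ≡ a * (b * (p * r)) * (x * y)
  lem = solve-∀

-- Bernoulli's inequality (1 + 1/U)^s ≥ 1 + s/U, with V ≥ U + 1 and denominators cleared.
bernoulli : ∀ U V s → U < V → (U + s) * U ^ s ≤ U * V ^ s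
bernoulli U V zero    U<V = ≤-reflexive (cong (_* 1) (+-identityʳ U))
bernoulli U V (suc s) U<V = begin
  (U + suc s) * (U * U ^ s)           ≤⟨ m≤m+n _ (s * U ^ s) ⟩
  (U + suc s) * (U * U ^ s) + s * U ^ s ≡⟨ lem U s (U ^ s) ⟩
  suc U * ((U + s) * U ^ s)           ≤⟨ *-mono-≤ U<V (bernoulli U V s U<V) ⟩
  V * (U * V ^ s)                     ≡⟨ lem′ V U (V ^ s) ⟩
  U * (V * V ^ s)                     ∎
  where
  open ≤-Reasoning
  lem : ∀ U s p → (U + suc s) * (U * p) + s * p ≡ suc U * ((U + s) * p)
  lem = solve-∀
  lem′ : ∀ a b p → a * (b * p) ≡ b * (a * p)
  lem′ = solve-∀

-- With e = d + 1 and q = r + s e, `bernoulli` gives s U^s ≤ U V^s. Its e-th power has s^(d+1) on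
-- the left, one power more than the polynomial needs, and s ≥ `S` absorbs the constants.
exp-beats-poly : ∀ U V → 1 ≤ U → U < V → ∀ d C → ∃ λ Q → ∀ q → Q ≤ q → C * (suc q ^ d * U ^ q) ≤ V ^ q
exp-beats-poly U V 1≤U U<V d C = e * S , λ q Qq → prf q Qq
  where
  open ≤-Reasoning
  e = suc d
  S = suc (C * ((2 * e) ^ d * U ^ e))
  instance
    U^e-nz : NonZero (U ^ e)
    U^e-nz = m^n≢0 U e {{>-nonZero 1≤U}}
  core : ∀ s → S ≤ s → C * ((2 * e * s) ^ d * U ^ (s * e)) ≤ V ^ (s * e)
  core s S≤s = *-cancelˡ-≤ (U ^ e) (begin
    U ^ e * (C * ((2 * e * s) ^ d * U ^ (s * e)))
      ≡⟨ cong (λ z → U ^ e * (C * (z * U ^ (s * e)))) (^-distribʳ-* d (2 * e) s) ⟩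
    U ^ e * (C * ((2 * e) ^ d * s ^ d * U ^ (s * e)))
      ≡⟨ lem (U ^ e) C ((2 * e) ^ d) (s ^ d) (U ^ (s * e)) ⟩
    C * ((2 * e) ^ d * U ^ e) * s ^ d * U ^ (s * e)
      ≤⟨ *-monoˡ-≤ (U ^ (s * e)) (*-monoˡ-≤ (s ^ d) (≤-trans (n≤1+n _) S≤s)) ⟩
    s * s ^ d * U ^ (s * e)
      ≡⟨ cong (s ^ e *_) (^-*-assoc U s e) ⟨
    s ^ e * (U ^ s) ^ e
      ≡⟨ ^-distribʳ-* e s (U ^ s) ⟨
    (s * U ^ s) ^ e
      ≤⟨ ^-monoˡ-≤ e (≤-trans (*-monoˡ-≤ (U ^ s) (m≤n+m s U)) (bernoulli U V s U<V)) ⟩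
    (U * V ^ s) ^ e
      ≡⟨ ^-distribʳ-* e U (V ^ s) ⟩
    U ^ e * (V ^ s) ^ e
      ≡⟨ cong (U ^ e *_) (^-*-assoc V s e) ⟩
    U ^ e * V ^ (s * e) ∎)
    where
    lem : ∀ u c x y z → u * (c * (x * y * z)) ≡ c * (x * u) * y * z
    lem = solve-∀
  prf : ∀ q → e * S ≤ q → C * (suc q ^ d * U ^ q) ≤ V ^ q
  prf q Q≤q = begin
    C * (suc q ^ d * U ^ q)
      ≤⟨ *-monoʳ-≤ C (*-mono-≤ (^-monoˡ-≤ d sucq≤) (≤-reflexive (trans (cong (U ^_) q≡) (^-distribˡ-+-* U r (s * e))))) ⟩
    C * ((2 * e * s) ^ d * (U ^ r * U ^ (s * e)))
      ≡⟨ lem C ((2 * e * s) ^ d) (U ^ r) (U ^ (s * e)) ⟩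
    U ^ r * (C * ((2 * e * s) ^ d * U ^ (s * e)))
      ≤⟨ *-mono-≤ (^-monoˡ-≤ r (<⇒≤ U<V)) (core s S≤s) ⟩
    V ^ r * V ^ (s * e)
      ≡⟨ trans (cong (V ^_) q≡) (^-distribˡ-+-* V r (s * e)) ⟨
    V ^ q ∎
    where
    s = q / e
    r = q % e
    q≡ : q ≡ r + s * e
    q≡ = m≡m%n+[m/n]*n q e
    S≤s : S ≤ s
    S≤s = ≤-trans (≤-reflexive (sym (m*n/m≡n′))) (/-monoˡ-≤ e Q≤q)
      where
      m*n/m≡n′ : e * S / e ≡ S
      m*n/m≡n′ = trans (cong (_/ e) (*-comm e S)) (m*n/n≡m S e)
    sucq≤ : suc q ≤ 2 * e * s
    sucq≤ = begin
      suc q              ≡⟨ cong suc q≡ ⟩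
      suc r + s * e      ≤⟨ +-monoˡ-≤ (s * e) (m%n<n q e) ⟩
      e + s * e          ≤⟨ +-monoˡ-≤ (s * e) (≤-trans (≤-reflexive (sym (*-identityˡ e))) (*-monoˡ-≤ e (≤-trans (s≤s z≤n) S≤s))) ⟩
      s * e + s * e      ≡⟨ lem₂ s e ⟩
      2 * e * s          ∎
      where
      lem₂ : ∀ s e → s * e + s * e ≡ 2 * e * s
      lem₂ = solve-∀
    lem : ∀ c x u y → c * (x * (u * y)) ≡ u * (c * (x * y))
    lem = solve-∀

-- Sums over lists and over subsets

𝟙 : Dec P → ℕ
𝟙 (yes _) = 1
𝟙 (no  _) = 0

𝟙-mono : {p : Dec P} {q : Dec Q} → (P → Q) → 𝟙 p ≤ 𝟙 q
𝟙-mono {p = no  _}               f = z≤n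
𝟙-mono {p = yes p} {q = yes _}   f = ≤-refl
𝟙-mono {p = yes p} {q = no ¬q}   f = ⊥-elim (¬q (f p))

𝟙-*-≤ : (p : Dec P) {x y : ℕ} → (P → x ≤ y) → 𝟙 p * x ≤ y
𝟙-*-≤ (yes p) {x} f = ≤-trans (≤-reflexive (+-identityʳ x)) (f p)
𝟙-*-≤ (no _)      f = z≤n

𝟙-yes : (p : Dec P) → P → 1 ≤ 𝟙 p
𝟙-yes (yes _) _ = ≤-refl
𝟙-yes (no ¬p) p = ⊥-elim (¬p p)

𝟙-no : (p : Dec P) → ¬ P → 𝟙 p ≤ 0
𝟙-no (yes p) ¬p = ⊥-elim (¬p p)
𝟙-no (no _)  _  = z≤n

𝟙-+-⊎ : (p : Dec P) (q : Dec Q) {R : Set} (r : Dec R) → (P → R) → (Q → R) → (P → ¬ Q) → 𝟙 p + 𝟙 q ≤ 𝟙 r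
𝟙-+-⊎ (yes p) (yes q) r f g h = ⊥-elim (h p q)
𝟙-+-⊎ (yes p) (no _)  r f g h = 𝟙-yes r (f p)
𝟙-+-⊎ (no _)  q       r f g h = 𝟙-mono {p = q} {q = r} g

∑ : List A → (A → ℕ) → ℕ
∑ []       f = 0
∑ (x ∷ xs) f = f x + ∑ xs f

∑-mono : (xs : List A) {f g : A → ℕ} → (∀ x → f x ≤ g x) → ∑ xs f ≤ ∑ xs g
∑-mono []       h = z≤n
∑-mono (x ∷ xs) h = +-mono-≤ (h x) (∑-mono xs h)

∑-cong : (xs : List A) {f g : A → ℕ} → (∀ x → f x ≡ g x) → ∑ xs f ≡ ∑ xs g
∑-cong []       h = refl
∑-cong (x ∷ xs) h = cong₂ _+_ (h x) (∑-cong xs h)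

∑-+ : (xs : List A) (f g : A → ℕ) → ∑ xs (λ x → f x + g x) ≡ ∑ xs f + ∑ xs g
∑-+ []       f g = refl
∑-+ (x ∷ xs) f g = trans (cong (f x + g x +_) (∑-+ xs f g)) (lem (f x) (g x) (∑ xs f) (∑ xs g))
  where
  lem : ∀ a b c d → a + b + (c + d) ≡ a + c + (b + d)
  lem = solve-∀

∑-*ʳ : (xs : List A) (f : A → ℕ) (c : ℕ) → ∑ xs (λ x → f x * c) ≡ ∑ xs f * c
∑-*ʳ []       f c = refl
∑-*ʳ (x ∷ xs) f c = trans (cong (f x * c +_) (∑-*ʳ xs f c)) (sym (*-distribʳ-+ c (f x) (∑ xs f)))

∑-0 : (xs : List A) → ∑ xs (λ _ → 0) ≡ 0
∑-0 []       = refl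
∑-0 (_ ∷ xs) = ∑-0 xs

∑-const : (xs : List A) (c : ℕ) → ∑ xs (λ _ → c) ≡ length xs * c
∑-const []       c = refl
∑-const (_ ∷ xs) c = cong (c +_) (∑-const xs c)

∑-swap : (xs : List A) (ys : List B) (f : A → B → ℕ) →
  ∑ xs (λ x → ∑ ys (f x)) ≡ ∑ ys (λ y → ∑ xs (λ x → f x y))
∑-swap []       ys f = sym (∑-0 ys)
∑-swap (x ∷ xs) ys f = trans (cong (∑ ys (f x) +_) (∑-swap xs ys f))
  (sym (∑-+ ys (f x) (λ y → ∑ xs (λ x′ → f x′ y))))

∑-++ : (xs ys : List A) (f : A → ℕ) → ∑ (xs ++ ys) f ≡ ∑ xs f + ∑ ys f
∑-++ []       ys f = refl
∑-++ (x ∷ xs) ys f = trans (cong (f x +_) (∑-++ xs ys f)) (sym (+-assoc (f x) _ _))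

∑-map : (g : A → B) (xs : List A) (f : B → ℕ) → ∑ (map g xs) f ≡ ∑ xs (f ∘ g)
∑-map g []       f = refl
∑-map g (x ∷ xs) f = cong (f (g x) +_) (∑-map g xs f)

length-filter≡∑ : {P : A → Set} (P? : Decidable P) (xs : List A) → length (filter P? xs) ≡ ∑ xs (λ x → 𝟙 (P? x))
length-filter≡∑ P? []       = refl
length-filter≡∑ P? (x ∷ xs) with P? x
... | yes _ = cong suc (length-filter≡∑ P? xs)
... | no  _ = length-filter≡∑ P? xs

∑-subsets : ∀ n (f : Subset (suc n) → ℕ) →
  ∑ (allSubsets (suc n)) f ≡ ∑ (allSubsets n) (f ∘ (true ∷_)) + ∑ (allSubsets n) (f ∘ (false ∷_))
∑-subsets n f = trans (∑-++ (map (true ∷_) (allSubsets n)) _ f)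
  (cong₂ _+_ (∑-map (true ∷_) (allSubsets n) f) (∑-map (false ∷_) (allSubsets n) f))

flip : ∀ {n} → Fin n → Subset n → Subset n
flip v S = updateAt S v not

-- `flip v` is an involution, so it permutes all subsets. Using it on all of them replaces the
-- bijection between sets with `v` and sets without `v`.
∑-flip : ∀ {n} (v : Fin n) (f : Subset n → ℕ) → ∑ (allSubsets n) (f ∘ flip v) ≡ ∑ (allSubsets n) f
∑-flip {suc n} zero f = trans (∑-subsets n (f ∘ flip zero))
  (trans (+-comm (∑ (allSubsets n) (f ∘ (false ∷_))) _) (sym (∑-subsets n f)))
∑-flip {suc n} (suc v) f = trans (∑-subsets n (f ∘ flip (suc v)))
  (trans (cong₂ _+_ (∑-flip v (f ∘ (true ∷_))) (∑-flip v (f ∘ (false ∷_)))) (sym (∑-subsets n f)))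

bit : Bool → ℕ
bit true  = 1
bit false = 0

∣∣-∷ : ∀ {n} b (S : Subset n) → ∣ b ∷ S ∣ ≡ bit b + ∣ S ∣
∣∣-∷ true  S = refl
∣∣-∷ false S = refl

∣∣≡∑ : ∀ {n} (S : Subset n) → ∣ S ∣ ≡ ∑ (allFin n) (bit ∘ lookup S)
∣∣≡∑ []      = refl
∣∣≡∑ {suc n} (b ∷ S) = trans (∣∣-∷ b S) (cong (bit b +_) (trans (∣∣≡∑ S)
  (trans (sym (∑-map suc (allFin n) (bit ∘ lookup (b ∷ S))))
         (cong (λ xs → ∑ xs (bit ∘ lookup (b ∷ S))) (map-tabulate id suc)))))

∣flip∣ : ∀ {n} (v : Fin n) (S : Subset n) → lookup S v ≡ false → ∣ flip v S ∣ ≡ suc ∣ S ∣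
∣flip∣ zero    (false ∷ S) refl = refl
∣flip∣ (suc v) (true ∷ S)  e    = cong suc (∣flip∣ v S e)
∣flip∣ (suc v) (false ∷ S) e    = ∣flip∣ v S e

remove : ∀ {n} → Fin n → Subset n → Subset n
remove v S = updateAt S v (λ _ → false)

∣remove∣ : ∀ {n} (v : Fin n) (S : Subset n) → ∣ S ∣ ≤ suc ∣ remove v S ∣
∣remove∣ zero    (true ∷ S)  = ≤-refl
∣remove∣ zero    (false ∷ S) = n≤1+n _
∣remove∣ (suc v) (true ∷ S)  = s≤s (∣remove∣ v S)
∣remove∣ (suc v) (false ∷ S) = ∣remove∣ v S

∣remove∣< : ∀ {n} (v : Fin n) (S : Subset n) → lookup S v ≡ true → suc ∣ remove v S ∣ ≡ ∣ S ∣
∣remove∣< zero    (true ∷ S)  refl = refl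
∣remove∣< (suc v) (true ∷ S)  e    = cong suc (∣remove∣< v S e)
∣remove∣< (suc v) (false ∷ S) e    = ∣remove∣< v S e

remove-lookup : ∀ {n} (v w : Fin n) (S : Subset n) → lookup (remove v S) w ≡ true → w ≢ v × lookup S w ≡ true
remove-lookup v w S e = w≢v , trans (sym (lookup∘updateAt′ w v w≢v S)) e
  where
  w≢v : w ≢ v
  w≢v refl with trans (sym e) (lookup∘updateAt v S)
  ... | ()

lookup-remove : ∀ {n} (v w : Fin n) (S : Subset n) → w ≢ v → lookup S w ≡ true → lookup (remove v S) w ≡ true
lookup-remove v w S w≢v e = trans (lookup∘updateAt′ w v w≢v S) e

-- Forests

-- A pigeonhole principle for a relation: an `x` may have many codes, as a tree has many parent
-- functions, and only decoding must be unique. The code taken by the head is deleted from `ys`; no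
-- other entry can use it, because it would decode to the head.
length-≤-by-code : (R : B → C → Set) → (∀ {x x′ y} → R x y → R x′ y → x ≡ x′) →
  {xs : List B} {ys : List C} → Unique xs →
  All (λ x → ∃ λ y → y List.∈ ys × R x y) xs → length xs ≤ length ys
length-≤-by-code R inj []        []                    = z≤n
length-≤-by-code R inj {x ∷ xs} (x∉ ∷ u) ((y , y∈ , r) ∷ codes) with ∈-∃++ y∈
... | as , bs , refl = ≤-trans (s≤s (length-≤-by-code R inj u (All.zipWith shrink (x∉ , codes))))
    (≤-reflexive (trans (cong suc (length-++ as)) (trans (sym (+-suc (length as) (length bs))) (sym (length-++ as)))))
  where
  shrink : ∀ {x′} → x ≢ x′ × (∃ λ z → z List.∈ as ++ y ∷ bs × R x′ z) → ∃ λ z → z List.∈ as ++ bs × R x′ z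
  shrink (x≢x′ , z , z∈ , r′) with ∈-++⁻ as z∈
  ... | inj₁ p           = z , ∈-++⁺ˡ p , r′
  ... | inj₂ (here refl) = ⊥-elim (x≢x′ (inj r r′))
  ... | inj₂ (there p)   = z , ∈-++⁺ʳ as p , r′

Unique-Fin-length : ∀ {n} {xs : List (Fin n)} → Unique xs → length xs ≤ n
Unique-Fin-length {n} u = ≤-trans
  (length-≤-by-code _≡_ (λ { refl refl → refl }) u (All.tabulate (λ {x} _ → x , ∈-allFin x , refl)))
  (≤-reflexive (length-tabulate {n = n} id))

upTo∈ : {w : B} {xs : List B} → w List.∈ xs → List B
upTo∈ {w = w}      (here _)  = w ∷ []
upTo∈ {xs = x ∷ _} (there m) = x ∷ upTo∈ m

upTo∈-All : {P : B → Set} {w : B} {xs : List B} (m : w List.∈ xs) → All P xs → All P (upTo∈ m)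
upTo∈-All (here refl) (p ∷ _)  = p ∷ []
upTo∈-All (there m)   (p ∷ ps) = p ∷ upTo∈-All m ps

upTo∈-Unique : {w : B} {xs : List B} (m : w List.∈ xs) → Unique xs → Unique (upTo∈ m)
upTo∈-Unique (here refl) _        = [] ∷ []
upTo∈-Unique (there m)   (x∉ ∷ u) = upTo∈-All m x∉ ∷ upTo∈-Unique m u

lastOf-upTo∈ : {w : B} {xs : List B} (v : B) (m : w List.∈ xs) → lastOf v (upTo∈ m) ≡ w
lastOf-upTo∈ v (here _)            = refl
lastOf-upTo∈ v (there {x = x} m) = lastOf-upTo∈ x m

upTo∈-Path : ∀ {n} (A : Adj n) {u w : Fin n} {xs : List (Fin n)} (m : w List.∈ xs) → Path A (u ∷ xs) → Path A (u ∷ upTo∈ m)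
upTo∈-Path A (here refl) (cons e _) = cons e one
upTo∈-Path A (there m)   (cons e p) = cons e (upTo∈-Path A m p)

nonempty : ∀ {n} (S : Subset n) → 1 ≤ ∣ S ∣ → ∃ λ s → lookup S s ≡ true
nonempty (true ∷ S)  _ = zero , refl
nonempty (false ∷ S) h with nonempty S h
... | s , e = suc s , e

module _ {n : ℕ} (A : Adj n) where
  private
    _∼_ : Fin n → Fin n → Set
    _∼_ = _~_ A

  _∼?_ : ∀ i j → Dec (i ∼ j)
  i ∼? j = lookup (lookup A i) j Bool.≟ true

  -- Degree zero is included: `u` only has to account for every neighbour of `v` in `S`, and need
  -- neither be adjacent to `v` nor lie in `S`.
  Leaf : Subset n → Fin n → Set
  Leaf S v = lookup S v ≡ true × ∃ λ u → ∀ w → lookup S w ≡ true → v ∼ w → w ≡ u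

  -- The stretch of the path from `v` to `w` is closed by the edge between its ends. Since `w` lies
  -- beyond `u`, at least three vertices occur.
  close-cycle : IsSimple A → ∀ {v u w rest} → Unique (v ∷ u ∷ rest) → Path A (v ∷ u ∷ rest) →
    (m : w List.∈ rest) → v ∼ w → IsCycle A (v ∷ u ∷ upTo∈ m)
  close-cycle (_ , symm) {v} {u} {w} ((v≢u ∷ v∉) ∷ u∉ ∷ uq) (cons e p) m@(here refl) v∼w =
    cyc ((v≢u ∷ upTo∈-All m v∉) ∷ upTo∈-All m u∉ ∷ upTo∈-Unique m uq) (cons e (upTo∈-Path A m p)) (symm v w v∼w)
  close-cycle (_ , symm) {v} {u} {w} ((v≢u ∷ v∉) ∷ u∉ ∷ uq) (cons e p) m@(there {x = x} m′) v∼w =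
    cyc ((v≢u ∷ upTo∈-All m v∉) ∷ upTo∈-All m u∉ ∷ upTo∈-Unique m uq) (cons e (upTo∈-Path A m p))
        (subst (_∼ v) (sym (lastOf-upTo∈ x m′)) (symm v w v∼w))

  -- Extend a path inside S at its head as long as possible; in an acyclic graph the final head is a leaf of S.
  extend : IsSimple A → IsAcyclic A → (S : Subset n) → ∀ f v ps → n ≤ f + length ps →
    Unique (v ∷ ps) → Path A (v ∷ ps) → lookup S v ≡ true → ∃ (Leaf S)
  -- `f` counts the extensions still possible: at zero the path would have more than n distinct
  -- vertices.
  extend simple acyclic S zero v ps n≤ uq _ _ = ⊥-elim (<⇒≱ (Unique-Fin-length uq) n≤)
  extend simple@(irr , symm) acyclic S (suc f) v ps n≤ uq path v∈S
    with any? (λ w → (lookup S w Bool.≟ true) ×-dec ((v ∼? w) ×-dec (¬? (w Fin.≟ lead ps))))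
    where
    lead : List (Fin n) → Fin n
    -- For a one-vertex path the default `v` excludes no neighbour, as there are no loops.
    lead []      = v
    lead (u ∷ _) = u
  ... | no none = v , v∈S , _ , λ w w∈S v∼w → decidable-stable (w Fin.≟ _) (λ w≢u → none (w , w∈S , v∼w , w≢u))
  ... | yes (w , w∈S , v∼w , w≢u) with DecMembership._∈?_ Fin._≟_ w (v ∷ ps)
  ...   | no w∉ = extend simple acyclic S f w (v ∷ ps)
          (≤-trans n≤ (≤-reflexive (sym (+-suc f (length ps)))))
          (All.tabulate (λ {x} x∈ w≡x → w∉ (subst (List._∈ (v ∷ ps)) (sym w≡x) x∈)) ∷ uq)
          (cons (symm v w v∼w) path) w∈S
  ...   | yes (here refl) = ⊥-elim (irr v v∼w)
  extend simple acyclic S (suc f) v (u ∷ rest) n≤ uq path v∈S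
        | yes (w , w∈S , v∼w , w≢u) | yes (there (here w≡u)) = ⊥-elim (w≢u w≡u)
  extend simple acyclic S (suc f) v (u ∷ rest) n≤ uq path v∈S
        | yes (w , w∈S , v∼w , w≢u) | yes (there (there m)) = ⊥-elim (acyclic _ (close-cycle simple uq path m v∼w))

  leaf-exists : IsSimple A → IsAcyclic A → (S : Subset n) → ∀ {s} → lookup S s ≡ true → ∃ (Leaf S)
  leaf-exists simple acyclic S {s} s∈S =
    extend simple acyclic S n s [] (≤-reflexive (sym (+-identityʳ n))) ([] ∷ []) one s∈S

  Orients : Subset n → (Fin n → Fin n) → Set
  Orients S p = ∀ i j → lookup S i ≡ true → lookup S j ≡ true → i ∼ j → p i ≡ j ⊎ p j ≡ i

  -- Induction by deleting a leaf `v` of `S`: its only possible edge into `S` goes to `u`, so `u`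
  -- becomes its parent, and only the value at `v` changes, which leaves the edges of the smaller
  -- set oriented. If `v` is isolated in `S`, the old value stays. The default `d` gives a neighbour
  -- to vertices that never receive a parent, such as a root, so that `p` is total.
  orientation-on : IsSimple A → IsAcyclic A → (d : Fin n → Fin n) → (∀ i → i ∼ d i) →
    ∀ s S → ∣ S ∣ ≡ s → ∃ λ p → (∀ i → i ∼ p i) × Orients S p
  orientation-on simple acyclic d d∼ zero S e = d , d∼ , λ i j i∈ _ _ → ⊥-elim (empty i i∈)
    where
    empty : ∀ i → lookup S i ≡ true → _
    empty i i∈ with trans (∣remove∣< i S i∈) e
    ... | ()
  orientation-on simple@(_ , symm) acyclic d d∼ (suc s) S e
    with nonempty S (≤-trans (s≤s z≤n) (≤-reflexive (sym e)))
  ... | _ , s∈ with leaf-exists simple acyclic S s∈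
  ... | v , v∈ , u , only
    with orientation-on simple acyclic d d∼ s (remove v S) (suc-injective (trans (∣remove∣< v S v∈) e))
  ... | p′ , p′∼ , or′ = p , p∼ , or
    where
    p : Fin n → Fin n
    p i with i Fin.≟ v
    ... | no _  = p′ i
    ... | yes _ with v ∼? u
    ...   | yes _ = u
    ...   | no _  = p′ i
    p∼ : ∀ i → i ∼ p i
    p∼ i with i Fin.≟ v
    ... | no _ = p′∼ i
    ... | yes refl with v ∼? u
    ...   | yes v∼u = v∼u
    ...   | no _    = p′∼ i
    pv : v ∼ u → p v ≡ u
    pv v∼u with v Fin.≟ v
    ... | no v≢v = ⊥-elim (v≢v refl)
    ... | yes _ with v ∼? u
    ...   | yes _  = refl
    ...   | no v≁u = ⊥-elim (v≁u v∼u)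
    p-other : ∀ i → i ≢ v → p i ≡ p′ i
    p-other i i≢v with i Fin.≟ v
    ... | yes i≡v = ⊥-elim (i≢v i≡v)
    ... | no _    = refl
    or : Orients S p
    or i j i∈ j∈ i∼j = by-cases (i Fin.≟ v) (j Fin.≟ v)
      where
      by-cases : Dec (i ≡ v) → Dec (j ≡ v) → p i ≡ j ⊎ p j ≡ i
      by-cases (yes refl) _ = inj₁ (trans (pv (subst (v ∼_) j≡u i∼j)) (sym j≡u))
        where
        j≡u : j ≡ u
        j≡u = only j j∈ i∼j
      by-cases (no _) (yes refl) = inj₂ (trans (pv (subst (v ∼_) i≡u (symm i j i∼j))) (sym i≡u))
        where
        i≡u : i ≡ u
        i≡u = only i i∈ (symm i j i∼j)
      by-cases (no i≢v) (no j≢v) with or′ i j (lookup-remove v i S i≢v i∈) (lookup-remove v j S j≢v j∈) i∼j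
      ... | inj₁ e′ = inj₁ (trans (p-other i i≢v) e′)
      ... | inj₂ e′ = inj₂ (trans (p-other j j≢v) e′)

-- Independent sets

true≢false : true ≢ false
true≢false ()

∑-subsets-≥ : ∀ {n} (f : Subset n → ℕ) S → f S ≤ ∑ (allSubsets n) f
∑-subsets-≥ f []          = m≤m+n (f []) 0
∑-subsets-≥ {suc n} f (true ∷ S)  = ≤-trans (∑-subsets-≥ (f ∘ (true ∷_)) S)
  (≤-trans (m≤m+n _ _) (≤-reflexive (sym (∑-subsets n f))))
∑-subsets-≥ {suc n} f (false ∷ S) = ≤-trans (∑-subsets-≥ (f ∘ (false ∷_)) S)
  (≤-trans (m≤n+m _ _) (≤-reflexive (sym (∑-subsets n f))))

_⊑_ : ∀ {n} → Subset n → Subset n → Set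
I ⊑ S = ∀ v → lookup I v ≡ true → lookup S v ≡ true

_⊑?_ : ∀ {n} (I S : Subset n) → Dec (I ⊑ S)
I ⊑? S = all? λ v → (lookup I v Bool.≟ true) →-dec (lookup S v Bool.≟ true)

∷-⊑ : ∀ {n} {I S : Subset n} {b c} → (b ≡ true → c ≡ true) → I ⊑ S → (b ∷ I) ⊑ (c ∷ S)
∷-⊑ h p zero    = h
∷-⊑ h p (suc v) = p v

Disjoint : ∀ {n} → Subset n → Subset n → Set
Disjoint I J = ∀ v → lookup I v ≡ true → lookup J v ≢ true

rest : ∀ {n} → Subset n → Subset n → Subset n
rest I J = zipWith (λ b c → not (b ∨ c)) I J

rest-size : ∀ {n} (I J : Subset n) → Disjoint I J → ∣ I ∣ + (∣ J ∣ + ∣ rest I J ∣) ≡ n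
rest-size []          []          d = refl
rest-size (true ∷ I)  (true ∷ J)  d = ⊥-elim (d zero refl refl)
rest-size (true ∷ I)  (false ∷ J) d = cong suc (rest-size I J (d ∘ suc))
rest-size (false ∷ I) (true ∷ J)  d = trans (+-suc ∣ I ∣ _) (cong suc (rest-size I J (d ∘ suc)))
rest-size (false ∷ I) (false ∷ J) d = trans (cong (∣ I ∣ +_) (+-suc ∣ J ∣ _))
  (trans (+-suc ∣ I ∣ _) (cong suc (rest-size I J (d ∘ suc))))

disjoint-sizes : ∀ {n} (I J : Subset n) → Disjoint I J → ∣ I ∣ + ∣ J ∣ ≤ n
disjoint-sizes I J d = ≤-trans (+-monoʳ-≤ ∣ I ∣ (m≤m+n ∣ J ∣ _)) (≤-reflexive (rest-size I J d))

-- Pascal's rule, according to whether the first element of `E` belongs to J. The slack in j + t ≤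
-- |E| lets heavy sets with different numbers of free vertices share one bound.
subsets-binom : ∀ {n} (E : Subset n) j t → j + t ≤ ∣ E ∣ →
  binom j t ≤ ∑ (allSubsets n) (λ J → 𝟙 ((J ⊑? E) ×-dec (∣ J ∣ ≟ j)))
subsets-binom [] zero zero _ = 𝟙-yes (([] ⊑? []) ×-dec (0 ≟ 0)) ((λ ()) , refl)
subsets-binom {suc n} (c ∷ E) j t h = ≤-trans (split c j t h) (≤-reflexive (sym (∑-subsets n _)))
  where
  count : Bool → Bool → ℕ → ℕ
  count c b j = ∑ (allSubsets n) (λ J → 𝟙 (((b ∷ J) ⊑? (c ∷ E)) ×-dec (∣ b ∷ J ∣ ≟ j)))
  without : ∀ c j t → j + t ≤ ∣ E ∣ → binom j t ≤ count c false j
  without c j t h = ≤-trans (subsets-binom E j t h)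
    (∑-mono (allSubsets n) λ J → 𝟙-mono λ (p , q) → ∷-⊑ (λ ()) p , q)
  within : ∀ j t → j + t ≤ ∣ E ∣ → binom j t ≤ count true true (suc j)
  within j t h = ≤-trans (subsets-binom E j t h)
    (∑-mono (allSubsets n) λ J → 𝟙-mono λ (p , q) → ∷-⊑ (λ _ → refl) p , cong suc q)
  split : ∀ c j t → j + t ≤ ∣ c ∷ E ∣ → binom j t ≤ count c true j + count c false j
  split false j t h = ≤-trans (without false j t h) (m≤n+m _ _)
  split true zero zero h = ≤-trans (without true 0 0 z≤n) (m≤n+m _ _)
  split true zero (suc t) (s≤s h) = ≤-trans (without true 0 t h) (m≤n+m _ _)
  split true (suc j) zero (s≤s h) = ≤-trans (≤-trans (≤-reflexive (sym (binom-zeroʳ j))) (within j 0 h)) (m≤m+n _ _)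
  split true (suc j) (suc t) (s≤s h) = +-mono-≤ (within j (suc t) h)
    (without true (suc j) t (≤-trans (≤-reflexive (sym (+-suc j t))) h))

module _ {n : ℕ} (A : Adj n) where
  private
    _∼_ : Fin n → Fin n → Set
    _∼_ = _~_ A

  indep⁺ : ∀ {S} → (∀ i j → lookup S i ≡ true → lookup S j ≡ true → ¬ i ∼ j) → IsIndependent A S
  indep⁺ h i j i∈ j∈ = h i j ([]=⇒lookup i∈) ([]=⇒lookup j∈)

  indep⁻ : ∀ {S} → IsIndependent A S → ∀ i j → lookup S i ≡ true → lookup S j ≡ true → ¬ i ∼ j
  indep⁻ {S} h i j i∈ j∈ = h i j (lookup⇒[]= i S i∈) (lookup⇒[]= j S j∈)

  OK : ℕ → Subset n → Set
  OK k I = IsIndependent A I × ∣ I ∣ ≡ k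

  OK? : ∀ k I → Dec (OK k I)
  OK? k I = isIndependent? A I ×-dec (∣ I ∣ ≟ k)

  X≡∑ : ∀ k → X A k ≡ ∑ (allSubsets n) (λ I → 𝟙 (OK? k I))
  X≡∑ k = length-filter≡∑ (OK? k) (allSubsets n)

  countIn : Subset n → ℕ → ℕ
  countIn S k = ∑ (allSubsets n) (λ I → 𝟙 ((I ⊑? S) ×-dec OK? k I))

  -- A k-set avoiding the leaf v and its neighbour u extends by v.
  countIn-leaf : IsSimple A → ∀ S k v → lookup S v ≡ true → ∀ u → (∀ w → lookup S w ≡ true → v ∼ w → w ≡ u) →
    countIn (remove u (remove v S)) k + countIn (remove v S) (suc k) ≤ countIn S (suc k)
  countIn-leaf (irr , symm) S k v v∈S u only = begin
    countIn S₂ k + countIn S₁ (suc k)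
      ≤⟨ +-mono-≤ (∑-mono (allSubsets n) (λ I → 𝟙-mono (insert I)))
                  (∑-mono (allSubsets n) (λ I → 𝟙-mono (avoid I))) ⟩
    ∑ (allSubsets n) (with-v ∘ flip v) + ∑ (allSubsets n) without-v
      ≡⟨ cong (_+ ∑ (allSubsets n) without-v) (∑-flip v with-v) ⟩
    ∑ (allSubsets n) with-v + ∑ (allSubsets n) without-v
      ≡⟨ ∑-+ (allSubsets n) with-v without-v ⟨
    ∑ (allSubsets n) (λ I → with-v I + without-v I)
      ≤⟨ ∑-mono (allSubsets n) (λ I → 𝟙-+-⊎ ((In? I) ×-dec (lookup I v Bool.≟ true)) ((In? I) ×-dec (lookup I v Bool.≟ false)) (In? I)
           proj₁ proj₁ (λ (_ , p) (_ , q) → true≢false (trans (sym p) q))) ⟩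
    countIn S (suc k) ∎
    where
    open ≤-Reasoning
    S₁ = remove v S
    S₂ = remove u S₁
    In? : ∀ I → Dec (I ⊑ S × OK (suc k) I)
    In? I = (I ⊑? S) ×-dec OK? (suc k) I
    with-v without-v : Subset n → ℕ
    with-v I    = 𝟙 ((In? I) ×-dec (lookup I v Bool.≟ true))
    without-v I = 𝟙 ((In? I) ×-dec (lookup I v Bool.≟ false))
    v∉ : ∀ I → I ⊑ S₁ → lookup I v ≡ false
    v∉ I p with lookup I v in e
    ... | false = refl
    ... | true  = ⊥-elim (proj₁ (remove-lookup v v S (p v e)) refl)
    avoid : ∀ I → I ⊑ S₁ × OK (suc k) I → (I ⊑ S × OK (suc k) I) × lookup I v ≡ false
    avoid I (p , ok) = ((λ w w∈ → proj₂ (remove-lookup v w S (p w w∈))) , ok) , v∉ I p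
    insert : ∀ I → I ⊑ S₂ × OK k I → (flip v I ⊑ S × OK (suc k) (flip v I)) × lookup (flip v I) v ≡ true
    insert I (p , ind , size) = (J⊑S , indep⁺ J-indep , trans (∣flip∣ v I v∉I) (cong suc size)) , trans (lookup∘updateAt v I) (cong not v∉I)
      where
      I⊑S₁ : I ⊑ S₁
      I⊑S₁ w w∈ = proj₂ (remove-lookup u w S₁ (p w w∈))
      I⊑S : I ⊑ S
      I⊑S w w∈ = proj₂ (remove-lookup v w S (I⊑S₁ w w∈))
      v∉I : lookup I v ≡ false
      v∉I = v∉ I I⊑S₁
      J⇒I : ∀ w → w ≢ v → lookup (flip v I) w ≡ true → lookup I w ≡ true
      J⇒I w w≢v w∈ = trans (sym (lookup∘updateAt′ w v w≢v I)) w∈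
      J⊑S : flip v I ⊑ S
      J⊑S w w∈ with w Fin.≟ v
      ... | yes refl = v∈S
      ... | no w≢v   = I⊑S w (J⇒I w w≢v w∈)
      v≁ : ∀ w → lookup I w ≡ true → ¬ v ∼ w
      v≁ w w∈ v∼w = proj₁ (remove-lookup u w S₁ (p w w∈)) (only w (I⊑S w w∈) v∼w)
      J-indep : ∀ i j → lookup (flip v I) i ≡ true → lookup (flip v I) j ≡ true → ¬ i ∼ j
      J-indep i j i∈ j∈ i∼j with i Fin.≟ v | j Fin.≟ v
      ... | yes refl | yes refl = irr i i∼j
      ... | yes refl | no j≢v   = v≁ j (J⇒I j j≢v j∈) i∼j
      ... | no i≢v   | yes refl = v≁ i (J⇒I i i≢v i∈) (symm i j i∼j)
      ... | no i≢v   | no j≢v   = indep⁻ ind i j (J⇒I i i≢v i∈) (J⇒I j j≢v j∈) i∼j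

  -- For 2k + t = |S| + 1 the left side is C(|S|+1-k,k), the count for a path on |S| vertices.
  -- Deleting a leaf costs one vertex, and deleting it with its neighbour at most two, so
  -- `countIn-leaf` reproduces Pascal's rule for `binom`.
  forest-countIn : IsSimple A → IsAcyclic A → ∀ k t S → 2 * k + t ≤ suc ∣ S ∣ → binom k t ≤ countIn S k
  forest-countIn simple acyclic zero t S h = ≤-trans
    (𝟙-yes ((⊥ ⊑? S) ×-dec OK? 0 ⊥)
      ((λ v v∈ → ⊥-elim (∉⊥ (lookup⇒[]= v ⊥ v∈))) , (λ i j i∈ → ⊥-elim (∉⊥ i∈)) , ∣⊥∣≡0 n))
    (∑-subsets-≥ (λ I → 𝟙 ((I ⊑? S) ×-dec OK? 0 I)) ⊥)
  forest-countIn simple acyclic (suc k) t S h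
    with nonempty S (s≤s⁻¹ (≤-trans (≤-trans (s≤s (s≤s z≤n)) (≤-reflexive (sym (lem k t)))) h))
    where
    lem : ∀ k t → 2 * suc k + t ≡ suc (suc (2 * k + t))
    lem = solve-∀
  ... | _ , s∈ with leaf-exists A simple acyclic S s∈
  ... | v , v∈ , u , only = ≤-trans (bound t h) (countIn-leaf simple S k v v∈ u only)
    where
    S₁ = remove v S
    S₂ = remove u S₁
    ∣S∣≤ : ∣ S ∣ ≤ suc (suc ∣ S₂ ∣)
    ∣S∣≤ = ≤-trans (∣remove∣ v S) (s≤s (∣remove∣ u S₁))
    fit : ∀ t → 2 * suc k + t ≤ suc ∣ S ∣ → 2 * k + t ≤ suc ∣ S₂ ∣
    fit t h = s≤s⁻¹ (s≤s⁻¹ (≤-trans (≤-reflexive (lem k t)) (≤-trans h (s≤s ∣S∣≤))))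
      where
      lem : ∀ k t → suc (suc (2 * k + t)) ≡ 2 * suc k + t
      lem = solve-∀
    bound : ∀ t → 2 * suc k + t ≤ suc ∣ S ∣ → binom (suc k) t ≤ countIn S₂ k + countIn S₁ (suc k)
    bound zero h = ≤-trans (≤-reflexive (sym (binom-zeroʳ k))) (≤-trans (forest-countIn simple acyclic k 0 S₂ (fit 0 h)) (m≤m+n _ _))
    bound (suc t) h = +-mono-≤
      (forest-countIn simple acyclic k (suc t) S₂ (fit (suc t) h))
      (forest-countIn simple acyclic (suc k) t S₁
        (≤-trans (s≤s⁻¹ (≤-trans (≤-reflexive (sym (+-suc (2 * suc k) t))) h)) (∣remove∣ v S)))

  forest-X : IsSimple A → IsAcyclic A → ∀ k t → 2 * k + t ≤ suc n → binom k t ≤ X A k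
  forest-X simple acyclic k t h = ≤-trans
    (forest-countIn simple acyclic k t ⊤ (subst (λ m → 2 * k + t ≤ suc m) (sym (∣⊤∣≡n n)) h))
    (≤-trans (∑-mono (allSubsets n) (λ I → 𝟙-mono proj₂)) (≤-reflexive (sym (X≡∑ k))))

  Free : Subset n → Fin n → Set
  Free I v = lookup I v ≡ false × (∀ w → lookup I w ≡ true → ¬ v ∼ w)

  Free? : ∀ I v → Dec (Free I v)
  Free? I v = (lookup I v Bool.≟ false) ×-dec all? λ w → (lookup I w Bool.≟ true) →-dec ¬? (_∼?_ A v w)

  free : Subset n → Subset n
  free I = tabulate (λ v → does (Free? I v))

  free⁺ : ∀ I v → Free I v → lookup (free I) v ≡ true
  free⁺ I v p = trans (lookup∘tabulate _ v) (dec-true (Free? I v) p)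

  free⁻ : ∀ I v → lookup (free I) v ≡ true → Free I v
  free⁻ I v e with Free? I v in eq
  ... | yes p = p
  ... | no ¬p = ⊥-elim (true≢false (trans (sym e) (trans (lookup∘tabulate _ v) (cong does eq))))

  -- Double counting of pairs (J , v) with v in J: removing v leaves an independent k-set for which
  -- v is free.
  X-suc-bound : ∀ k → X A (suc k) * suc k ≤ ∑ (allSubsets n) (λ I → 𝟙 (OK? k I) * ∣ free I ∣)
  X-suc-bound k = begin
    X A (suc k) * suc k
      ≡⟨ cong (_* suc k) (X≡∑ (suc k)) ⟩
    ∑ Ss (λ J → 𝟙 (OK? (suc k) J)) * suc k
      ≡⟨ ∑-*ʳ Ss _ (suc k) ⟨
    ∑ Ss (λ J → 𝟙 (OK? (suc k) J) * suc k)
      ≤⟨ ∑-mono Ss (λ J → 𝟙-*-≤ (OK? (suc k) J) (λ ok → ≤-trans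
           (≤-reflexive (trans (sym (proj₂ ok)) (∣∣≡∑ J))) (∑-mono (allFin n) (member J ok)))) ⟩
    ∑ Ss (λ J → ∑ (allFin n) (λ v → inc v J))
      ≡⟨ ∑-swap Ss (allFin n) (λ J v → inc v J) ⟩
    ∑ (allFin n) (λ v → ∑ Ss (inc v))
      -- Reindexing by J = `flip v I`. The next step discards all I except those to which v is
      -- added.
      ≡⟨ ∑-cong (allFin n) (λ v → ∑-flip v (inc v)) ⟨
    ∑ (allFin n) (λ v → ∑ Ss (inc v ∘ flip v))
      ≤⟨ ∑-mono (allFin n) (λ v → ∑-mono Ss (λ I → 𝟙-mono (shrink v I))) ⟩
    ∑ (allFin n) (λ v → ∑ Ss (λ I → ext v I))
      ≡⟨ ∑-swap Ss (allFin n) (λ I v → ext v I) ⟨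
    ∑ Ss (λ I → ∑ (allFin n) (λ v → ext v I))
      ≤⟨ ∑-mono Ss collect ⟩
    ∑ Ss (λ I → 𝟙 (OK? k I) * ∣ free I ∣) ∎
    where
    open ≤-Reasoning
    Ss = allSubsets n
    inc ext : Fin n → Subset n → ℕ
    inc v J = 𝟙 (OK? (suc k) J ×-dec (lookup J v Bool.≟ true))
    ext v I = 𝟙 (OK? k I ×-dec (lookup (free I) v Bool.≟ true))
    member : ∀ J → OK (suc k) J → ∀ v → bit (lookup J v) ≤ inc v J
    member J ok v with lookup J v in e
    ... | false = z≤n
    ... | true  = 𝟙-yes (OK? (suc k) J ×-dec (true Bool.≟ true)) (ok , refl)
    shrink : ∀ v I → OK (suc k) (flip v I) × lookup (flip v I) v ≡ true → OK k I × lookup (free I) v ≡ true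
    shrink v I ((ind , size) , v∈J) =
      (indep⁺ (λ i j i∈ j∈ → indep⁻ ind i j (up i i∈) (up j j∈)) , suc-injective (trans (sym (∣flip∣ v I v∉)) size)) ,
      free⁺ I v (v∉ , λ w w∈ → indep⁻ ind v w v∈J (up w w∈))
      where
      v∉ : lookup I v ≡ false
      v∉ with lookup I v in e | trans (sym (lookup∘updateAt v {not} I)) v∈J
      ... | false | _ = refl
      ... | true  | ()
      up : ∀ w → lookup I w ≡ true → lookup (flip v I) w ≡ true
      up w w∈ = trans (lookup∘updateAt′ w v (λ { refl → true≢false (trans (sym w∈) v∉) }) I) w∈
    collect : ∀ I → ∑ (allFin n) (λ v → ext v I) ≤ 𝟙 (OK? k I) * ∣ free I ∣
    collect I = begin
      ∑ (allFin n) (λ v → ext v I)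
        ≤⟨ ∑-mono (allFin n) pointwise ⟩
      ∑ (allFin n) (λ v → bit (lookup (free I) v) * 𝟙 (OK? k I))
        ≡⟨ ∑-*ʳ (allFin n) _ (𝟙 (OK? k I)) ⟩
      ∑ (allFin n) (bit ∘ lookup (free I)) * 𝟙 (OK? k I)
        ≡⟨ cong (_* 𝟙 (OK? k I)) (∣∣≡∑ (free I)) ⟨
      ∣ free I ∣ * 𝟙 (OK? k I)
        ≡⟨ *-comm ∣ free I ∣ _ ⟩
      𝟙 (OK? k I) * ∣ free I ∣ ∎
      where
      pointwise : ∀ v → ext v I ≤ bit (lookup (free I) v) * 𝟙 (OK? k I)
      pointwise v with lookup (free I) v
      ... | true  = ≤-trans (𝟙-mono {p = OK? k I ×-dec (true Bool.≟ true)} {q = OK? k I} proj₁) (≤-reflexive (sym (+-identityʳ _)))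
      ... | false = 𝟙-no (OK? k I ×-dec (false Bool.≟ true)) (λ ())

  heavy : ℕ → ℕ
  heavy k = ∑ (allSubsets n) (λ I → 𝟙 (OK? k I ×-dec (suc k ≤? ∣ free I ∣)))

  -- An ascent yields at least (X_k + 1)(k + 1) pairs of a k-set and a free vertex. Allowing k for
  -- every k-set covers the light ones, so more than X_k pairs remain for heavy sets, each of which
  -- has at most n free vertices.
  many-heavy : ∀ k → X A k < X A (suc k) → X A k < heavy k * n
  many-heavy k X< = +-cancelˡ-≤ (X A k * k) _ _ (begin
    X A k * k + suc (X A k)      ≡⟨ lem (X A k) k ⟩
    suc (X A k * suc k)          ≤⟨ s≤s (m≤n+m _ k) ⟩
    suc (X A k) * suc k          ≤⟨ *-monoˡ-≤ (suc k) X< ⟩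
    X A (suc k) * suc k          ≤⟨ X-suc-bound k ⟩
    ∑ Ss (λ I → 𝟙 (OK? k I) * ∣ free I ∣)
                                 ≤⟨ ∑-mono Ss split ⟩
    ∑ Ss (λ I → 𝟙 (OK? k I) * k + 𝟙 (H? I) * n)
                                 ≡⟨ ∑-+ Ss _ _ ⟩
    ∑ Ss (λ I → 𝟙 (OK? k I) * k) + ∑ Ss (λ I → 𝟙 (H? I) * n)
                                 ≡⟨ cong₂ _+_ (∑-*ʳ Ss _ k) (∑-*ʳ Ss _ n) ⟩
    ∑ Ss (λ I → 𝟙 (OK? k I)) * k + heavy k * n
                                 ≡⟨ cong (λ x → x * k + heavy k * n) (X≡∑ k) ⟨
    X A k * k + heavy k * n      ∎)
    where
    open ≤-Reasoning
    Ss = allSubsets n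
    lem : ∀ x k → x * k + suc x ≡ suc (x * suc k)
    lem = solve-∀
    H? : ∀ I → Dec (OK k I × suc k ≤ ∣ free I ∣)
    H? I = OK? k I ×-dec (suc k ≤? ∣ free I ∣)
    split : ∀ I → 𝟙 (OK? k I) * ∣ free I ∣ ≤ 𝟙 (OK? k I) * k + 𝟙 (H? I) * n
    split I with suc k ≤? ∣ free I ∣
    ... | no ≰ = ≤-trans (*-monoʳ-≤ (𝟙 (OK? k I)) (s≤s⁻¹ (≰⇒> ≰))) (m≤m+n _ _)
    ... | yes k< = ≤-trans
      (*-mono-≤ (𝟙-mono {p = OK? k I} {q = OK? k I ×-dec yes k<} (_, k<)) (∣p∣≤n (free I)))
      (m≤n+m _ _)

  Pair : ℕ → ℕ → Subset n → Subset n → Set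
  Pair k j I J = OK k I × J ⊑ free I × ∣ J ∣ ≡ j

  Pair? : ∀ k j I J → Dec (Pair k j I J)
  Pair? k j I J = OK? k I ×-dec ((J ⊑? free I) ×-dec (∣ J ∣ ≟ j))

  pairs : ℕ → ℕ → ℕ
  pairs k j = ∑ (allSubsets n) (λ I → ∑ (allSubsets n) (λ J → 𝟙 (Pair? k j I J)))

  heavy-pairs : ∀ k j t → j + t ≤ suc k → heavy k * binom j t ≤ pairs k j
  heavy-pairs k j t j+t≤ = ≤-trans (≤-reflexive (sym (∑-*ʳ (allSubsets n) _ (binom j t))))
    (∑-mono (allSubsets n) λ I → 𝟙-*-≤ (OK? k I ×-dec (suc k ≤? ∣ free I ∣)) λ (ok , k<) →
      ≤-trans (subsets-binom (free I) j t (≤-trans j+t≤ k<))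
        (∑-mono (allSubsets n) λ J → 𝟙-mono (ok ,_)))

  pairs-lower-bound : IsSimple A → IsAcyclic A → ∀ k j t t′ → X A k < X A (suc k) →
    2 * k + t ≤ suc n → j + t′ ≤ suc k → binom k t * binom j t′ ≤ n * pairs k j
  pairs-lower-bound simple acyclic k j t t′ X< 2k+t≤ j+t′≤ = begin
    binom k t * binom j t′            ≤⟨ *-monoˡ-≤ (binom j t′) (forest-X simple acyclic k t 2k+t≤) ⟩
    X A k * binom j t′                ≤⟨ *-monoˡ-≤ (binom j t′) (<⇒≤ (many-heavy k X<)) ⟩
    heavy k * n * binom j t′          ≡⟨ lem (heavy k) n (binom j t′) ⟩
    n * (heavy k * binom j t′)        ≤⟨ *-monoʳ-≤ n (heavy-pairs k j t′ j+t′≤) ⟩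
    n * pairs k j                     ∎
    where
    open ≤-Reasoning
    lem : ∀ h n b → h * n * b ≡ n * (h * b)
    lem = solve-∀

  -- A heavy set and its k + 1 free vertices are disjoint, so 2k + 1 ≤ n. Beyond one half there are
  -- no heavy sets, which contradicts `many-heavy`.
  ascent-below-half : ∀ k → X A k < X A (suc k) → 2 * k < n
  ascent-below-half k X< = ≰⇒> λ n≤2k → 1+n≰n (begin
    1                 ≤⟨ s≤s z≤n ⟩
    suc (X A k)       ≤⟨ many-heavy k X< ⟩
    heavy k * n       ≤⟨ *-monoˡ-≤ n (∑-mono (allSubsets n) (λ I → 𝟙-no (OK? k I ×-dec (suc k ≤? ∣ free I ∣)) (none n≤2k I))) ⟩
    ∑ (allSubsets n) (λ _ → 0) * n  ≡⟨ cong (_* n) (∑-0 (allSubsets n)) ⟩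
    0                 ∎)
    where
    open ≤-Reasoning
    none : n ≤ 2 * k → ∀ I → ¬ (OK k I × suc k ≤ ∣ free I ∣)
    none n≤2k I ((_ , size) , k<) = 1+n≰n (begin
      suc (2 * k)                 ≡⟨ lem k ⟩
      k + suc k                   ≤⟨ +-mono-≤ (≤-reflexive (sym size)) k< ⟩
      ∣ I ∣ + ∣ free I ∣          ≤⟨ disjoint-sizes I (free I) (λ v v∈ v∈′ → true≢false (trans (sym v∈) (proj₁ (free⁻ I v v∈′)))) ⟩
      n                           ≤⟨ n≤2k ⟩
      2 * k                       ∎)
      where
      lem : ∀ k → suc (2 * k) ≡ k + suc k
      lem = solve-∀

-- Counting trees

length-cartesianProductWith : (f : B → C → D) (xs : List B) (ys : List C) →
  length (cartesianProductWith f xs ys) ≡ length xs * length ys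
length-cartesianProductWith f []       ys = refl
length-cartesianProductWith f (x ∷ xs) ys = trans (length-++ (map (f x) ys))
  (cong₂ _+_ (length-map (f x) ys) (length-cartesianProductWith f xs ys))

vecs : ∀ {m} → Vec (List B) m → List (Vec B m)
vecs []         = [] ∷ []
vecs (xs ∷ xss) = cartesianProductWith _∷_ xs (vecs xss)

∈-vecs : ∀ {m} (xss : Vec (List B) m) (f : Fin m → B) →
  (∀ i → f i List.∈ lookup xss i) → tabulate f List.∈ vecs xss
∈-vecs []         f h = here refl
∈-vecs (xs ∷ xss) f h = ∈-cartesianProductWith⁺ _∷_ (h zero) (∈-vecs xss (f ∘ suc) (h ∘ suc))

elements : ∀ {n} → Subset n → List (Fin n)
elements []          = []
elements (true ∷ S)  = zero ∷ map suc (elements S)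
elements (false ∷ S) = map suc (elements S)

length-elements : ∀ {n} (S : Subset n) → length (elements S) ≡ ∣ S ∣
length-elements []          = refl
length-elements (true ∷ S)  = cong suc (trans (length-map suc (elements S)) (length-elements S))
length-elements (false ∷ S) = trans (length-map suc (elements S)) (length-elements S)

∈-elements : ∀ {n} (S : Subset n) v → lookup S v ≡ true → v List.∈ elements S
∈-elements (true ∷ S)  zero    e = here refl
∈-elements (true ∷ S)  (suc v) e = there (∈-map⁺ suc (∈-elements S v e))
∈-elements (false ∷ S) (suc v) e = ∈-map⁺ suc (∈-elements S v e)

-- A product over the vertices of a weight that depends on membership in I and in J. It is used
-- twice: as the number of parent functions for (I , J), and as a multinomial weight.
∏ : (Bool → Bool → ℕ) → ∀ {m} → Vec Bool m → Vec Bool m → ℕ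
∏ w []      []      = 1
∏ w (b ∷ I) (c ∷ J) = w b c * ∏ w I J

∏-disjoint : ∀ w {m} (I J : Subset m) → Disjoint I J →
  ∏ w I J ≡ w true false ^ ∣ I ∣ * (w false true ^ ∣ J ∣ * w false false ^ ∣ rest I J ∣)
∏-disjoint w []          []          d = refl
∏-disjoint w (true ∷ I)  (true ∷ J)  d = ⊥-elim (d zero refl refl)
∏-disjoint w (true ∷ I)  (false ∷ J) d = trans (cong (w true false *_) (∏-disjoint w I J (d ∘ suc)))
  (sym (*-assoc (w true false) _ _))
∏-disjoint w (false ∷ I) (true ∷ J)  d = trans (cong (w false true *_) (∏-disjoint w I J (d ∘ suc)))
  (lem (w false true) (w true false ^ ∣ I ∣) (w false true ^ ∣ J ∣) (w false false ^ ∣ rest I J ∣))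
  where
  lem : ∀ x p q r → x * (p * (q * r)) ≡ p * (x * q * r)
  lem = solve-∀
∏-disjoint w (false ∷ I) (false ∷ J) d = trans (cong (w false false *_) (∏-disjoint w I J (d ∘ suc)))
  (lem (w false false) (w true false ^ ∣ I ∣) (w false true ^ ∣ J ∣) (w false false ^ ∣ rest I J ∣))
  where
  lem : ∀ x p q r → x * (p * (q * r)) ≡ p * (q * (x * r))
  lem = solve-∀

-- The multinomial theorem: expanding the power assigns each vertex one of four membership types.
∑∑-∏ : ∀ w n → ∑ (allSubsets n) (λ I → ∑ (allSubsets n) (∏ w I)) ≡
  (w true true + w true false + w false true + w false false) ^ n
∑∑-∏ w zero    = refl
∑∑-∏ w (suc n) = begin
  ∑ (allSubsets (suc n)) (λ I → ∑ (allSubsets (suc n)) (∏ w I))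
    ≡⟨ ∑-subsets n _ ⟩
  ∑ Ss (λ I → ∑ (allSubsets (suc n)) (∏ w (true ∷ I))) + ∑ Ss (λ I → ∑ (allSubsets (suc n)) (∏ w (false ∷ I)))
    ≡⟨ cong₂ _+_ (row true) (row false) ⟩
  total * (w true true + w true false) + total * (w false true + w false false)
    ≡⟨ lem total (w true true) (w true false) (w false true) (w false false) ⟩
  (w true true + w true false + w false true + w false false) * total
    ≡⟨ cong ((w true true + w true false + w false true + w false false) *_) (∑∑-∏ w n) ⟩
  (w true true + w true false + w false true + w false false) ^ suc n ∎
  where
  open ≡-Reasoning
  Ss = allSubsets n
  total = ∑ Ss (λ I → ∑ Ss (∏ w I))
  lem : ∀ t a b c d → t * (a + b) + t * (c + d) ≡ (a + b + c + d) * t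
  lem = solve-∀
  scale : ∀ x I → ∑ Ss (λ J → x * ∏ w I J) ≡ ∑ Ss (∏ w I) * x
  scale x I = trans (∑-cong Ss (λ J → *-comm x (∏ w I J))) (∑-*ʳ Ss (∏ w I) x)
  row : ∀ b → ∑ Ss (λ I → ∑ (allSubsets (suc n)) (∏ w (b ∷ I))) ≡ total * (w b true + w b false)
  row b = begin
    ∑ Ss (λ I → ∑ (allSubsets (suc n)) (∏ w (b ∷ I)))
      ≡⟨ ∑-cong Ss (λ I → trans (∑-subsets n (∏ w (b ∷ I))) (trans
           (cong₂ _+_ (scale (w b true) I) (scale (w b false) I))
           (sym (*-distribˡ-+ (∑ Ss (∏ w I)) (w b true) (w b false))))) ⟩
    ∑ Ss (λ I → ∑ Ss (∏ w I) * (w b true + w b false))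
      ≡⟨ ∑-*ʳ Ss _ (w b true + w b false) ⟩
    total * (w b true + w b false) ∎

length-vecs : ∀ (f : Bool → Bool → List B) {m} (I J : Vec Bool m) →
  length (vecs (zipWith f I J)) ≡ ∏ (λ b c → length (f b c)) I J
length-vecs f []      []      = refl
length-vecs f (b ∷ I) (c ∷ J) = trans (length-cartesianProductWith _∷_ (f b c) (vecs (zipWith f I J)))
  (cong (length (f b c) *_) (length-vecs f I J))

module _ {n : ℕ} (I J : Subset n) where
  -- Where the parent of a vertex may lie. From I it avoids I by independence and J because J is
  -- free; from J it only avoids I, since edges inside J are allowed. The first case is empty, as I
  -- and J are disjoint.
  choices : Bool → Bool → List (Fin n)
  choices true  true  = []
  choices true  false = elements (rest I J)
  choices false true  = elements (∁ I)
  choices false false = allFin n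

  codes : List (Vec (Fin n) n)
  codes = vecs (zipWith choices I J)

  length-codes : Disjoint I J → length codes ≡ ∣ rest I J ∣ ^ ∣ I ∣ * ((n ∸ ∣ I ∣) ^ ∣ J ∣ * n ^ ∣ rest I J ∣)
  length-codes d = trans (length-vecs choices I J) (trans (∏-disjoint (λ b c → length (choices b c)) I J d)
    (cong₂ (λ x y → x ^ ∣ I ∣ * y) (length-elements (rest I J))
      (cong₂ (λ x y → x ^ ∣ J ∣ * y ^ ∣ rest I J ∣) (trans (length-elements (∁ I)) (∣∁p∣≡n∸∣p∣ I)) (length-tabulate {n = n} id))))

Codes : ∀ {n} → Adj n → Vec (Fin n) n → Set
Codes A y = (∀ i → _~_ A i (lookup y i)) × (∀ i j → _~_ A i j → lookup y i ≡ j ⊎ lookup y j ≡ i)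

-- In `Codes A y` each pair of i and y i is an edge, and every edge is such a pair. The edge set can
-- thus be read off from `y`.
Codes-injective : ∀ {n} {A A′ : Adj n} (y : Vec (Fin n) n) → IsSimple A × Codes A y → IsSimple A′ × Codes A′ y → A ≡ A′
Codes-injective {n} {A} {A′} y (sA , cA) (sA′ , cA′) =
  ext (λ i → ext (λ j → same-bit (transfer A A′ cA sA′ cA′ i j) (transfer A′ A cA′ sA cA i j)))
  where
  ext : {B : Set} {m : ℕ} {u v : Vec B m} → (∀ i → lookup u i ≡ lookup v i) → u ≡ v
  ext {u = u} {v} h = trans (sym (tabulate∘lookup u)) (trans (tabulate-cong h) (tabulate∘lookup v))
  same-bit : ∀ {b c} → (b ≡ true → c ≡ true) → (c ≡ true → b ≡ true) → b ≡ c
  same-bit {true}  f g = sym (f refl)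
  same-bit {false} {true}  f g = g refl
  same-bit {false} {false} f g = refl
  transfer : (A A′ : Adj n) → Codes A y → IsSimple A′ → Codes A′ y → ∀ i j → _~_ A i j → _~_ A′ i j
  transfer A A′ (_ , edges) (_ , symm) (nbr , _) i j i~j with edges i j i~j
  ... | inj₁ refl = nbr i
  ... | inj₂ refl = symm _ _ (nbr j)

neighbour : ∀ {n} (A : Adj n) → 2 ≤ n → IsConnected A → ∀ i → ∃ λ j → _~_ A i j
neighbour A (s≤s (s≤s z≤n)) conn i with other i
  where
  other : ∀ {m} (i : Fin (suc (suc m))) → ∃ λ j → i ≢ j
  other zero    = suc zero , λ ()
  other (suc i) = zero , λ ()
... | k , i≢k with conn i k
...   | here     = ⊥-elim (i≢k refl)
...   | step e _ = _ , e

Ascent : ∀ {n} → ℕ → Adj n → Set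
Ascent k A = IsTree A × X A k < X A (suc k)

module _ {n : ℕ} where
  tree-code : 2 ≤ n → (A : Adj n) → IsTree A → ∀ k j I J → Pair A k j I J →
    ∃ λ y → y List.∈ codes I J × IsSimple A × Codes A y
  tree-code 2≤n A (simple@(_ , symm) , conn , acyclic) k j I J ((ind , _) , J⊑ , _)
    with orientation-on A simple acyclic (proj₁ ∘ neighbour A 2≤n conn) (proj₂ ∘ neighbour A 2≤n conn) _ ⊤ refl
  ... | p , p∼ , orients = tabulate p , ∈-vecs (zipWith (choices I J) I J) p in-choices , simple ,
      (λ i → subst (_~_ A i) (sym (lookup∘tabulate p i)) (p∼ i)) ,
      λ a b a∼b → subst₂ (λ x y → x ≡ b ⊎ y ≡ a) (sym (lookup∘tabulate p a)) (sym (lookup∘tabulate p b))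
        (orients a b (in-⊤ a) (in-⊤ b) a∼b)
    where
    in-⊤ : ∀ i → lookup ⊤ i ≡ true
    in-⊤ i = []=⇒lookup (∈⊤ {x = i})
    not-true : ∀ {b} → b ≢ true → b ≡ false
    not-true {true}  h = ⊥-elim (h refl)
    not-true {false} h = refl
    in-choices : ∀ i → p i List.∈ lookup (zipWith (choices I J) I J) i
    in-choices i = subst (p i List.∈_) (sym (lookup-zipWith (choices I J) i I J)) (go (lookup I i) (lookup J i) refl refl)
      where
      go : ∀ b c → lookup I i ≡ b → lookup J i ≡ c → p i List.∈ choices I J b c
      go true true i∈I i∈J = ⊥-elim (true≢false (trans (sym i∈I) (proj₁ (free⁻ A I i (J⊑ i i∈J)))))
      go true false i∈I _ = ∈-elements (rest I J) (p i) (trans (lookup-zipWith _ (p i) I J)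
        (cong₂ (λ x y → not (x ∨ y))
          (not-true λ pi∈I → indep⁻ A ind i (p i) i∈I pi∈I (p∼ i))
          (not-true λ pi∈J → proj₂ (free⁻ A I (p i) (J⊑ (p i) pi∈J)) i i∈I (symm i (p i) (p∼ i)))))
      go false true _ i∈J = ∈-elements (∁ I) (p i) (trans (lookup-map (p i) not I)
        (cong not (not-true λ pi∈I → proj₂ (free⁻ A I i (J⊑ i i∈J)) (p i) pi∈I (p∼ i))))
      go false false _ _ = ∈-allFin (p i)

  Shape : ℕ → ℕ → Subset n → Subset n → Set
  Shape k j I J = ∣ I ∣ ≡ k × ∣ J ∣ ≡ j × Disjoint I J

  Shape? : ∀ k j I J → Dec (Shape k j I J)
  Shape? k j I J = (∣ I ∣ ≟ k) ×-dec ((∣ J ∣ ≟ j) ×-dec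
    all? λ v → (lookup I v Bool.≟ true) →-dec ¬? (lookup J v Bool.≟ true))

  shapes : ℕ → ℕ → ℕ
  shapes k j = ∑ (allSubsets n) (λ I → ∑ (allSubsets n) (λ J → 𝟙 (Shape? k j I J)))

  rest-size-≡ : ∀ {k j c} I J → k + (j + c) ≡ n → Shape k j I J → ∣ rest I J ∣ ≡ c
  rest-size-≡ {k} {j} {c} I J sum (refl , refl , d) =
    +-cancelˡ-≡ j _ _ (+-cancelˡ-≡ k _ _ (trans (rest-size I J d) (sym sum)))

  -- `shapes k j` is the multinomial coefficient n!/(k! j! c!), bounded by one term of (a+b+g)^n. No
  -- factorials occur, and the bound is tight up to polynomial factors when the weights are
  -- proportional to k, j and c.
  shapes-bound : ∀ a b g k j c → k + (j + c) ≡ n → shapes k j * (a ^ k * (b ^ j * g ^ c)) ≤ (a + b + g) ^ n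
  shapes-bound a b g k j c sum = begin
    shapes k j * W
      ≡⟨ ∑-*ʳ Ss _ W ⟨
    ∑ Ss (λ I → ∑ Ss (λ J → 𝟙 (Shape? k j I J)) * W)
      ≡⟨ ∑-cong Ss (λ I → ∑-*ʳ Ss _ W) ⟨
    ∑ Ss (λ I → ∑ Ss (λ J → 𝟙 (Shape? k j I J) * W))
      ≤⟨ ∑-mono Ss (λ I → ∑-mono Ss (λ J → 𝟙-*-≤ (Shape? k j I J) (weigh I J))) ⟩
    ∑ Ss (λ I → ∑ Ss (∏ w I))
      ≡⟨ ∑∑-∏ w n ⟩
    (a + b + g) ^ n ∎
    where
    open ≤-Reasoning
    Ss = allSubsets n
    W = a ^ k * (b ^ j * g ^ c)
    w : Bool → Bool → ℕ
    -- Weight zero removes the overlapping pairs from the expansion.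
    w true  true  = 0
    w true  false = a
    w false true  = b
    w false false = g
    weigh : ∀ I J → Shape k j I J → W ≤ ∏ w I J
    weigh I J s@(refl , refl , d) = ≤-reflexive (sym (trans (∏-disjoint w I J d)
      (cong (λ c → a ^ k * (b ^ j * g ^ c)) (rest-size-≡ I J sum s))))

  pairs-upper-bound : 2 ≤ n → ∀ k j c → k + (j + c) ≡ n → (L : List (Adj n)) → Unique L → All IsTree L →
    ∑ L (λ A → pairs A k j) ≤ shapes k j * (c ^ k * ((n ∸ k) ^ j * n ^ c))
  pairs-upper-bound 2≤n k j c sum L uniq trees = begin
    ∑ L (λ A → ∑ Ss (λ I → ∑ Ss (λ J → 𝟙 (Pair? A k j I J))))
      ≡⟨ ∑-swap L Ss _ ⟩
    ∑ Ss (λ I → ∑ L (λ A → ∑ Ss (λ J → 𝟙 (Pair? A k j I J))))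
      ≡⟨ ∑-cong Ss (λ I → ∑-swap L Ss _) ⟩
    ∑ Ss (λ I → ∑ Ss (λ J → ∑ L (λ A → 𝟙 (Pair? A k j I J))))
      ≤⟨ ∑-mono Ss (λ I → ∑-mono Ss (per-shape I)) ⟩
    ∑ Ss (λ I → ∑ Ss (λ J → 𝟙 (Shape? k j I J) * W))
      ≡⟨ ∑-cong Ss (λ I → ∑-*ʳ Ss _ W) ⟩
    ∑ Ss (λ I → ∑ Ss (λ J → 𝟙 (Shape? k j I J)) * W)
      ≡⟨ ∑-*ʳ Ss _ W ⟩
    shapes k j * W ∎
    where
    open ≤-Reasoning
    Ss = allSubsets n
    W = c ^ k * ((n ∸ k) ^ j * n ^ c)
    pair⇒shape : ∀ A I J → Pair A k j I J → Shape k j I J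
    pair⇒shape A I J ((_ , ∣I∣) , J⊑ , ∣J∣) = ∣I∣ , ∣J∣ ,
      λ v v∈I v∈J → true≢false (trans (sym v∈I) (proj₁ (free⁻ A I v (J⊑ v v∈J))))
    per-shape : ∀ I J → ∑ L (λ A → 𝟙 (Pair? A k j I J)) ≤ 𝟙 (Shape? k j I J) * W
    per-shape I J with Shape? k j I J
    ... | no ¬shape = ≤-trans (∑-mono L (λ A → 𝟙-no (Pair? A k j I J) (¬shape ∘ pair⇒shape A I J))) (≤-reflexive (∑-0 L))
    ... | yes s@(refl , refl , d) = begin
      ∑ L (λ A → 𝟙 (P? A))         ≡⟨ length-filter≡∑ P? L ⟨
      length (filter P? L)         ≤⟨ length-≤-by-code (λ A y → IsSimple A × Codes A y) (λ {_} {_} {y} → Codes-injective y)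
                                        (Unique.filter⁺ P? uniq)
                                        (All.zipWith (λ {A} (P , tree) → tree-code 2≤n A tree k j I J P) (All.all-filter P? L , All.filter⁺ P? trees)) ⟩
      length (codes I J)           ≡⟨ length-codes I J d ⟩
      ∣ rest I J ∣ ^ k * ((n ∸ k) ^ j * n ^ ∣ rest I J ∣)
                                   ≡⟨ cong (λ c → c ^ k * ((n ∸ k) ^ j * n ^ c)) (rest-size-≡ I J sum s) ⟩
      W                            ≡⟨ +-identityʳ W ⟨
      1 * W ∎
      where
      P? : ∀ A → Dec (Pair A k j I J)
      P? A = Pair? A k j I J

  -- Markov's inequality with denominators cleared. The weights `a`, `b`, `g` are arbitrary, and
  -- `t`, `t′` are constrained only by inequalities, so that one choice of constants can serve a
  -- whole range of k.
  first-moment : 2 ≤ n → ∀ a b g k j c t t′ → k + (j + c) ≡ n → 2 * k + t ≤ suc n → j + t′ ≤ suc k →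
    (L : List (Adj n)) → Unique L → All (Ascent k) L →
    length L * (binom k t * binom j t′) * (a ^ k * (b ^ j * g ^ c)) ≤
      n * ((a + b + g) ^ n * (c ^ k * ((n ∸ k) ^ j * n ^ c)))
  first-moment 2≤n a b g k j c t t′ sum 2k+t≤ j+t′≤ L uniq all = begin
    length L * M * w
      ≡⟨ cong (_* w) (∑-const L M) ⟨
    ∑ L (λ _ → M) * w
      ≤⟨ *-monoˡ-≤ w (lower L all) ⟩
    ∑ L (λ A → pairs A k j * n) * w
      ≡⟨ cong (_* w) (∑-*ʳ L _ n) ⟩
    ∑ L (λ A → pairs A k j) * n * w
      ≤⟨ *-monoˡ-≤ w (*-monoˡ-≤ n (pairs-upper-bound 2≤n k j c sum L uniq (All.map proj₁ all))) ⟩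
    shapes k j * W * n * w
      ≡⟨ lem (shapes k j) W n w ⟩
    n * (shapes k j * w * W)
      ≤⟨ *-monoʳ-≤ n (*-monoˡ-≤ W (shapes-bound a b g k j c sum)) ⟩
    n * ((a + b + g) ^ n * W) ∎
    where
    open ≤-Reasoning
    M = binom k t * binom j t′
    w = a ^ k * (b ^ j * g ^ c)
    W = c ^ k * ((n ∸ k) ^ j * n ^ c)
    lem : ∀ s W n w → s * W * n * w ≡ n * (s * w * W)
    lem = solve-∀
    lower : ∀ L → All (Ascent k) L → ∑ L (λ _ → M) ≤ ∑ L (λ A → pairs A k j * n)
    lower []      []                                       = z≤n
    lower (A ∷ L) (((simple , _ , acyclic) , X<) ∷ all) = +-mono-≤
      (≤-trans (pairs-lower-bound A simple acyclic k j t t′ X< 2k+t≤ j+t′≤) (≤-reflexive (*-comm n _))) (lower L all)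

-- Exponential rates

-- Repeated squaring, since the rates below are integers with hundreds of thousands of digits.
pow : ℕ → ℕ → ℕ → ℕ
pow zero    x n = x ^ n
pow (suc f) x n = x ^ (n % 2) * pow f (x * x) (n / 2)

pow≡^ : ∀ f x n → pow f x n ≡ x ^ n
pow≡^ zero    x n = refl
pow≡^ (suc f) x n = begin
  x ^ (n % 2) * pow f (x * x) (n / 2)  ≡⟨ cong (x ^ (n % 2) *_) (pow≡^ f (x * x) (n / 2)) ⟩
  x ^ (n % 2) * (x * x) ^ (n / 2)      ≡⟨ cong (λ y → x ^ (n % 2) * (x * y) ^ (n / 2)) (*-identityʳ x) ⟨
  x ^ (n % 2) * (x ^ 2) ^ (n / 2)      ≡⟨ cong (x ^ (n % 2) *_) (^-*-assoc x 2 (n / 2)) ⟩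
  x ^ (n % 2) * x ^ (2 * (n / 2))      ≡⟨ ^-distribˡ-+-* x (n % 2) (2 * (n / 2)) ⟨
  x ^ (n % 2 + 2 * (n / 2))            ≡⟨ cong (x ^_) (trans (cong (n % 2 +_) (*-comm 2 (n / 2))) (sym (m≡m%n+[m/n]*n n 2))) ⟩
  x ^ n                                ∎
  where open ≡-Reasoning

-- With a/D ≤ k/n ≤ h/D and j/n ≈ b/D, each further D vertices multiply the first-moment bound on the
-- proportion of exceptional trees by about upper/lower; here f = a - b, g = D - a - b and t = D - 2h.
upper lower : (ℕ → ℕ → ℕ) → (D a b f g t : ℕ) → ℕ
upper _**_ D a b f g t = (t ** t) * ((f ** f) * ((D ** g) * ((g ** a) * ((b + g) ** b))))
lower _**_ D a b f g t = ((a + t) ** (a + t)) * ((a ** a) * (g ** g))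

-- Opaque, so that these integers are never recomputed when types are compared.
opaque
  Separated : (D a b f g t : ℕ) → Set
  -- Twenty halvings reduce every exponent below 2^20 to zero; `pow` is correct for any fuel, which
  -- affects only its speed.
  Separated D a b f g t = T (upper (pow 20) D a b f g t <ᵇ lower (pow 20) D a b f g t)

  separated⇒< : ∀ D a b f g t → Separated D a b f g t → upper _^_ D a b f g t < lower _^_ D a b f g t
  separated⇒< D a b f g t s = subst₂ _<_
    (cong₂ _*_ (pow≡^ 20 t t) (cong₂ _*_ (pow≡^ 20 f f) (cong₂ _*_ (pow≡^ 20 D g) (cong₂ _*_ (pow≡^ 20 g a) (pow≡^ 20 (b + g) b)))))
    (cong₂ _*_ (pow≡^ 20 (a + t) (a + t)) (cong₂ _*_ (pow≡^ 20 a a) (pow≡^ 20 g g)))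
    (<ᵇ⇒< _ _ s)

-- In the cell k/n runs from a/D to h/D. The left end represents k throughout, except in `t`: 2k + t
-- q ≤ n + 1 must hold up to the right end, so `t` is D - 2h. This mismatch weakens the bound on X_k
-- and limits the length of a cell.
record Cell (D a h : ℕ) : Set where
  field
    b f g t   : ℕ
    a-split   : a ≡ b + f
    D-split   : D ≡ a + b + g
    h-split   : D ≡ 2 * h + t
    b-pos     : 1 ≤ b
    g-pos     : 1 ≤ g
    g²≤aD     : g * g ≤ a * D
    separated : Separated D a b f g t

1≤^ : ∀ x n → 1 ≤ x → 1 ≤ x ^ n
1≤^ x n 1≤x = >-nonZero⁻¹ (x ^ n) {{m^n≢0 x n {{>-nonZero 1≤x}}}}

1≤n^n : ∀ n → 1 ≤ n ^ n
1≤n^n zero    = ≤-refl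
1≤n^n (suc n) = 1≤^ (suc n) (suc n) (s≤s z≤n)

^-mono-exp : ∀ x {m n} → 1 ≤ x → m ≤ n → x ^ m ≤ x ^ n
^-mono-exp x 1≤x m≤n = ^-monoʳ-≤ x {{>-nonZero 1≤x}} m≤n

-- Stated for a variable s, because the powers of a successor unfold when types are compared.
collect : ∀ N K x s y d u → N * (K * (x * s * (y * s) * (d * s ^ 4)) * u) ≡ N * (K * (x * y * d) * (s ^ 6 * u))
collect = lem
  where
  lem : ∀ N K x s y d u → N * (K * (x * s * (y * s) * (d * (s * (s * (s * (s * 1)))))) * u) ≡
    N * (K * (x * y * d) * (s * (s * (s * (s * (s * (s * 1))))) * u))
  lem = solve-∀

module _ {D a h : ℕ} (C : Cell D a h) where
  open Cell C

  private
    e : ℕ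
    e = b + g
    -- The factors by which the two sides of `rate` grow with each block of D vertices. They are
    -- `upper` and `lower` times the common factor `M₀`, which is left out of the numerical test.
    U₀ V₀ : ℕ
    U₀ = (a ^ a * t ^ t) * (b ^ b * f ^ f) * (D ^ D * (g * g) ^ a * (e * g) ^ b)
    V₀ = (a + t) ^ (a + t) * a ^ a * ((a * D) ^ a * (b * D) ^ b * g ^ D)
    M₀ : ℕ
    M₀ = a ^ a * (b ^ b * ((D ^ a * D ^ b) * (g ^ a * g ^ b)))

  1≤D : 1 ≤ D
  1≤D = ≤-trans g-pos (≤-trans (m≤n+m g (a + b)) (≤-reflexive (sym D-split)))

  private
    instance
      D-nz : NonZero D
      D-nz = >-nonZero 1≤D

  ^-D : ∀ x → x ^ D ≡ x ^ a * x ^ b * x ^ g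
  ^-D x = trans (cong (x ^_) D-split) (trans (^-distribˡ-+-* x (a + b) g) (cong (_* x ^ g) (^-distribˡ-+-* x a b)))

  U₀≡ : U₀ ≡ upper _^_ D a b f g t * M₀
  U₀≡ = trans (cong (λ z → (a ^ a * t ^ t) * (b ^ b * f ^ f) * z)
          (cong₂ _*_ (cong₂ _*_ (^-D D) (^-distribʳ-* a g g)) (^-distribʳ-* b e g)))
        (lem (a ^ a) (t ^ t) (b ^ b) (f ^ f) (D ^ a) (D ^ b) (D ^ g) (g ^ a) (e ^ b) (g ^ b))
    where
    lem : ∀ aa tt bb ff Da Db Dg ga eb gb →
      (aa * tt) * (bb * ff) * (Da * Db * Dg * (ga * ga) * (eb * gb)) ≡
      tt * (ff * (Dg * (ga * eb))) * (aa * (bb * ((Da * Db) * (ga * gb))))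
    lem = solve-∀

  V₀≡ : V₀ ≡ lower _^_ D a b f g t * M₀
  V₀≡ = trans (cong (λ z → (a + t) ^ (a + t) * a ^ a * z)
          (cong₂ _*_ (cong₂ _*_ (^-distribʳ-* a a D) (^-distribʳ-* b b D)) (^-D g)))
        (lem ((a + t) ^ (a + t)) (a ^ a) (D ^ a) (b ^ b) (D ^ b) (g ^ a) (g ^ b) (g ^ g))
    where
    lem : ∀ v aa Da bb Db ga gb gg →
      v * aa * (aa * Da * (bb * Db) * (ga * gb * gg)) ≡
      v * (aa * gg) * (aa * (bb * ((Da * Db) * (ga * gb))))
    lem = solve-∀

  U₀<V₀ : U₀ < V₀
  U₀<V₀ = subst₂ _<_ (sym U₀≡) (sym V₀≡)
    (*-monoˡ-< M₀ {{>-nonZero 1≤M₀}} (separated⇒< D a b f g t separated))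
    where
    1≤M₀ : 1 ≤ M₀
    1≤M₀ = *-mono-≤ (1≤n^n a) (*-mono-≤ (1≤n^n b) (*-mono-≤
      (*-mono-≤ (1≤^ D a 1≤D) (1≤^ D b 1≤D)) (*-mono-≤ (1≤^ g a g-pos) (1≤^ g b g-pos))))

  1≤eg : 1 ≤ e * g
  1≤eg = *-mono-≤ (≤-trans b-pos (m≤m+n b g)) g-pos

  1≤gg : 1 ≤ g * g
  1≤gg = *-mono-≤ g-pos g-pos

  1≤U₀ : 1 ≤ U₀
  1≤U₀ = *-mono-≤ (*-mono-≤ (*-mono-≤ (1≤n^n a) (1≤n^n t)) (*-mono-≤ (1≤n^n b) (1≤n^n f)))
    (*-mono-≤ (*-mono-≤ (1≤n^n D) (1≤^ (g * g) a 1≤gg)) (1≤^ (e * g) b 1≤eg))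

  K : ℕ
  K = D ^ D * (e * g) ^ suc b

  module _ (n k q j c ℓ : ℕ) (sum : k + (j + c) ≡ n)
    (qD≤n : D * q ≤ n) (n≤ : n ≤ D * q + D)
    (aq≤k : a * q ≤ k) (bq≤j : b * q ≤ j) (j≤ : j ≤ b * q + suc b)
    (Dc≤ : D * c ≤ g * n) (Dn-k≤ : D * (n ∸ k) ≤ e * n) where
    open ≤-Reasoning

    -- k may be replaced by a q because g² ≤ a D, and n and j by D q and b q at the cost of the constant K.
    normalise : ∀ P → ℓ * P * (a ^ k * (b ^ j * g ^ c)) ≤ n * (D ^ n * (c ^ k * ((n ∸ k) ^ j * n ^ c))) →
      ℓ * P * ((a * D) ^ (a * q) * (b * D) ^ (b * q) * g ^ (D * q)) ≤
      n * n ^ n * K * (D ^ (D * q) * (g * g) ^ (a * q) * (e * g) ^ (b * q))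
    normalise P hyp = *-cancelʳ-≤ _ _ ((g * g) ^ k) {{>-nonZero (1≤^ (g * g) k 1≤gg)}} (begin
      ℓ * P * ((a * D) ^ (a * q) * (b * D) ^ (b * q) * g ^ (D * q)) * (g * g) ^ k
        ≡⟨ lem₁ (ℓ * P) ((a * D) ^ (a * q)) ((b * D) ^ (b * q)) (g ^ (D * q)) ((g * g) ^ k) ⟩
      ℓ * P * ((a * D) ^ (a * q) * (g * g) ^ k * ((b * D) ^ (b * q) * g ^ (D * q)))
        ≤⟨ *-monoʳ-≤ (ℓ * P) (*-mono-≤ shift (*-mono-≤
             (^-mono-exp (b * D) (*-mono-≤ b-pos 1≤D) bq≤j) (^-mono-exp g g-pos qD≤n))) ⟩
      ℓ * P * ((a * D) ^ k * (g * g) ^ (a * q) * ((b * D) ^ j * g ^ n))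
        ≡⟨ lem₂ (ℓ * P) ((a * D) ^ k) ((g * g) ^ (a * q)) ((b * D) ^ j) (g ^ n) ⟩
      ℓ * P * ((a * D) ^ k * ((b * D) ^ j * g ^ n)) * (g * g) ^ (a * q)
        ≤⟨ *-monoˡ-≤ ((g * g) ^ (a * q)) homogeneous ⟩
      n * n ^ n * D ^ n * ((g * g) ^ k * (e * g) ^ j) * (g * g) ^ (a * q)
        ≤⟨ *-monoˡ-≤ ((g * g) ^ (a * q)) (*-mono-≤
             (*-monoʳ-≤ (n * n ^ n) (≤-trans (^-mono-exp D 1≤D n≤) (≤-reflexive (^-distribˡ-+-* D (D * q) D))))
             (*-monoʳ-≤ ((g * g) ^ k) (≤-trans (^-mono-exp (e * g) 1≤eg j≤) (≤-reflexive (^-distribˡ-+-* (e * g) (b * q) (suc b)))))) ⟩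
      n * n ^ n * (D ^ (D * q) * D ^ D) * ((g * g) ^ k * ((e * g) ^ (b * q) * (e * g) ^ suc b)) * (g * g) ^ (a * q)
        ≡⟨ lem₃ (n * n ^ n) (D ^ (D * q)) (D ^ D) ((g * g) ^ k) ((e * g) ^ (b * q)) ((e * g) ^ suc b) ((g * g) ^ (a * q)) ⟩
      n * n ^ n * K * (D ^ (D * q) * (g * g) ^ (a * q) * (e * g) ^ (b * q)) * (g * g) ^ k ∎)
      where
      lem₁ : ∀ p x y z w → p * (x * y * z) * w ≡ p * (x * w * (y * z))
      lem₁ = solve-∀
      lem₂ : ∀ p x y z w → p * (x * y * (z * w)) ≡ p * (x * (z * w)) * y
      lem₂ = solve-∀
      lem₃ : ∀ p x y z w v u → p * (x * y) * (z * (w * v)) * u ≡ p * (y * v) * (x * u * w) * z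
      lem₃ = solve-∀
      d = k ∸ a * q
      k≡ : a * q + d ≡ k
      k≡ = m+[n∸m]≡n aq≤k
      shift : (a * D) ^ (a * q) * (g * g) ^ k ≤ (a * D) ^ k * (g * g) ^ (a * q)
      shift = begin
        x ^ (a * q) * y ^ k                      ≡⟨ cong (λ m → x ^ (a * q) * y ^ m) k≡ ⟨
        x ^ (a * q) * y ^ (a * q + d)            ≡⟨ cong (x ^ (a * q) *_) (^-distribˡ-+-* y (a * q) d) ⟩
        x ^ (a * q) * (y ^ (a * q) * y ^ d)      ≤⟨ *-monoʳ-≤ (x ^ (a * q)) (*-monoʳ-≤ (y ^ (a * q)) (^-monoˡ-≤ d g²≤aD)) ⟩
        x ^ (a * q) * (y ^ (a * q) * x ^ d)      ≡⟨ lem (x ^ (a * q)) (y ^ (a * q)) (x ^ d) ⟩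
        x ^ (a * q) * x ^ d * y ^ (a * q)        ≡⟨ cong (_* y ^ (a * q)) (^-distribˡ-+-* x (a * q) d) ⟨
        x ^ (a * q + d) * y ^ (a * q)            ≡⟨ cong (λ m → x ^ m * y ^ (a * q)) k≡ ⟩
        x ^ k * y ^ (a * q)                      ∎
        where
        x = a * D
        y = g * g
        lem : ∀ u v w → u * (v * w) ≡ u * w * v
        lem = solve-∀
      ^-sum : ∀ x → x ^ n ≡ x ^ k * (x ^ j * x ^ c)
      ^-sum x = trans (cong (x ^_) (sym sum)) (trans (^-distribˡ-+-* x k (j + c)) (cong (x ^ k *_) (^-distribˡ-+-* x j c)))
      -- Multiplying by D^k D^j g^k g^j makes the bounds on D c and D (n - k) applicable; the powers
      -- of n then collect into n^n.
      homogeneous : ℓ * P * ((a * D) ^ k * ((b * D) ^ j * g ^ n)) ≤ n * n ^ n * D ^ n * ((g * g) ^ k * (e * g) ^ j)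
      homogeneous = begin
        ℓ * P * ((a * D) ^ k * ((b * D) ^ j * g ^ n))
          ≡⟨ cong (ℓ * P *_) (cong₂ _*_ (^-distribʳ-* k a D) (cong₂ _*_ (^-distribʳ-* j b D) (^-sum g))) ⟩
        ℓ * P * (a ^ k * D ^ k * (b ^ j * D ^ j * (g ^ k * (g ^ j * g ^ c))))
          ≡⟨ lem (ℓ * P) (a ^ k) (D ^ k) (b ^ j) (D ^ j) (g ^ k) (g ^ j) (g ^ c) ⟩
        ℓ * P * (a ^ k * (b ^ j * g ^ c)) * (D ^ k * D ^ j * (g ^ k * g ^ j))
          ≤⟨ *-monoˡ-≤ _ hyp ⟩
        n * (D ^ n * (c ^ k * ((n ∸ k) ^ j * n ^ c))) * (D ^ k * D ^ j * (g ^ k * g ^ j))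
          ≡⟨ lem′ n (D ^ n) (c ^ k) ((n ∸ k) ^ j) (n ^ c) (D ^ k) (D ^ j) (g ^ k) (g ^ j) ⟩
        n * D ^ n * n ^ c * (g ^ k * g ^ j) * (D ^ k * c ^ k * (D ^ j * (n ∸ k) ^ j))
          ≡⟨ cong (n * D ^ n * n ^ c * (g ^ k * g ^ j) *_) (cong₂ _*_ (^-distribʳ-* k D c) (^-distribʳ-* j D (n ∸ k))) ⟨
        n * D ^ n * n ^ c * (g ^ k * g ^ j) * ((D * c) ^ k * (D * (n ∸ k)) ^ j)
          ≤⟨ *-monoʳ-≤ (n * D ^ n * n ^ c * (g ^ k * g ^ j)) (*-mono-≤ (^-monoˡ-≤ k Dc≤) (^-monoˡ-≤ j Dn-k≤)) ⟩
        n * D ^ n * n ^ c * (g ^ k * g ^ j) * ((g * n) ^ k * (e * n) ^ j)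
          ≡⟨ cong (n * D ^ n * n ^ c * (g ^ k * g ^ j) *_) (cong₂ _*_ (^-distribʳ-* k g n) (^-distribʳ-* j e n)) ⟩
        n * D ^ n * n ^ c * (g ^ k * g ^ j) * (g ^ k * n ^ k * (e ^ j * n ^ j))
          ≡⟨ lem″ n (D ^ n) (n ^ c) (g ^ k) (g ^ j) (n ^ k) (e ^ j) (n ^ j) ⟩
        n * (n ^ k * (n ^ j * n ^ c)) * D ^ n * (g ^ k * g ^ k * (e ^ j * g ^ j))
          ≡⟨ cong₂ (λ u v → n * u * D ^ n * v) (^-sum n) (cong₂ _*_ (^-distribʳ-* k g g) (^-distribʳ-* j e g)) ⟨
        n * n ^ n * D ^ n * ((g * g) ^ k * (e * g) ^ j) ∎
        where
        lem : ∀ p ak Dk bj Dj gk gj gc → p * (ak * Dk * (bj * Dj * (gk * (gj * gc)))) ≡ p * (ak * (bj * gc)) * (Dk * Dj * (gk * gj))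
        lem = solve-∀
        lem′ : ∀ n Dn ck mj nc Dk Dj gk gj → n * (Dn * (ck * (mj * nc))) * (Dk * Dj * (gk * gj)) ≡ n * Dn * nc * (gk * gj) * (Dk * ck * (Dj * mj))
        lem′ = solve-∀
        lem″ : ∀ n Dn nc gk gj nk ej nj → n * Dn * nc * (gk * gj) * (gk * nk * (ej * nj)) ≡ n * (nk * (nj * nc)) * Dn * (gk * gk * (ej * gj))
        lem″ = solve-∀

    -- `binom-entropy-scaled` is applied to C((a+t)q, aq) and, by a = b + f, to C(aq, bq). These
    -- give the linear factors in q and the factors a^a t^t and b^b f^f of `U₀`; `normalise` gives
    -- the rest.
    rate : 1 ≤ q → ℓ * (binom (a * q) (t * q) * binom (b * q) (f * q)) * (a ^ k * (b ^ j * g ^ c)) ≤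
        n * (D ^ n * (c ^ k * ((n ∸ k) ^ j * n ^ c))) →
      ℓ * V₀ ^ q ≤ suc ((a + t) * q) * suc (a * q) * (n * n ^ n * K) * U₀ ^ q
    rate 1≤q hyp = begin
      ℓ * V₀ ^ q
        ≡⟨ cong (ℓ *_) (trans (^-distribʳ-* q (v * aa) _) (cong₂ _*_ (^-distribʳ-* q v aa)
             (trans (^-distribʳ-* q ((a * D) ^ a * (b * D) ^ b) (g ^ D)) (cong₂ _*_
               (trans (^-distribʳ-* q ((a * D) ^ a) ((b * D) ^ b)) (cong₂ _*_ (^-*-assoc (a * D) a q) (^-*-assoc (b * D) b q)))
               (^-*-assoc g D q))))) ⟩
      ℓ * (v ^ q * aa ^ q * R)
        ≤⟨ *-monoʳ-≤ ℓ (*-monoˡ-≤ R (*-mono-≤ (binom-entropy-scaled a t q 1≤q) ent₂)) ⟩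
      ℓ * (suc ((a + t) * q) * (P₁ * (aa * t ^ t) ^ q) * (suc (a * q) * (P₂ * (b ^ b * f ^ f) ^ q)) * R)
        ≡⟨ lem ℓ (suc ((a + t) * q)) P₁ ((aa * t ^ t) ^ q) (suc (a * q)) P₂ ((b ^ b * f ^ f) ^ q) R ⟩
      suc ((a + t) * q) * suc (a * q) * ((aa * t ^ t) ^ q * (b ^ b * f ^ f) ^ q) * (ℓ * (P₁ * P₂) * R)
        ≤⟨ *-monoʳ-≤ (suc ((a + t) * q) * suc (a * q) * ((aa * t ^ t) ^ q * (b ^ b * f ^ f) ^ q)) (normalise (P₁ * P₂) hyp) ⟩
      suc ((a + t) * q) * suc (a * q) * ((aa * t ^ t) ^ q * (b ^ b * f ^ f) ^ q) * (n * n ^ n * K * S)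
        ≡⟨ lem′ (suc ((a + t) * q) * suc (a * q)) ((aa * t ^ t) ^ q) ((b ^ b * f ^ f) ^ q) (n * n ^ n * K) S ⟩
      suc ((a + t) * q) * suc (a * q) * (n * n ^ n * K) * ((aa * t ^ t) ^ q * (b ^ b * f ^ f) ^ q * S)
        ≡⟨ cong (suc ((a + t) * q) * suc (a * q) * (n * n ^ n * K) *_)
             (trans (^-distribʳ-* q ((aa * t ^ t) * (b ^ b * f ^ f)) _) (cong₂ _*_ (^-distribʳ-* q (aa * t ^ t) (b ^ b * f ^ f))
             (trans (^-distribʳ-* q (D ^ D * (g * g) ^ a) ((e * g) ^ b)) (cong₂ _*_
               (trans (^-distribʳ-* q (D ^ D) ((g * g) ^ a)) (cong₂ _*_ (^-*-assoc D D q) (^-*-assoc (g * g) a q)))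
               (^-*-assoc (e * g) b q))))) ⟨
      suc ((a + t) * q) * suc (a * q) * (n * n ^ n * K) * U₀ ^ q ∎
      where
      v = (a + t) ^ (a + t)
      aa = a ^ a
      P₁ = binom (a * q) (t * q)
      P₂ = binom (b * q) (f * q)
      R = (a * D) ^ (a * q) * (b * D) ^ (b * q) * g ^ (D * q)
      S = D ^ (D * q) * (g * g) ^ (a * q) * (e * g) ^ (b * q)
      ent₂ : aa ^ q ≤ suc (a * q) * (P₂ * (b ^ b * f ^ f) ^ q)
      ent₂ = subst (λ x → (x ^ x) ^ q ≤ suc (x * q) * (P₂ * (b ^ b * f ^ f) ^ q)) (sym a-split) (binom-entropy-scaled b f q 1≤q)
      lem : ∀ l p P x r Q y R → l * (p * (P * x) * (r * (Q * y)) * R) ≡ p * r * (x * y) * (l * (P * Q) * R)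
      lem = solve-∀
      lem′ : ∀ p x y N S → p * (x * y) * (N * S) ≡ p * N * (x * y * S)
      lem′ = solve-∀

  cell-rate : ∀ n k → 2 ≤ n → 1 ≤ n / D → a * n ≤ D * k → D * k ≤ h * n → 2 * k < n →
    (L : List (Adj n)) → Unique L → All (Ascent k) L →
    length L * V₀ ^ (n / D) ≤ suc ((a + t) * (n / D)) * suc (a * (n / D)) * (n * n ^ n * K) * U₀ ^ (n / D)
  cell-rate n k 2≤n 1≤q an≤Dk Dk≤hn 2k<n L uniq bad =
    rate n k q j c (length L) sum qD≤n (<⇒≤ n<) aq≤k bq≤j j≤ Dc≤ Dn-k≤ 1≤q (begin
      length L * (binom (a * q) (t * q) * binom (b * q) (f * q)) * (a ^ k * (b ^ j * g ^ c))
        ≤⟨ *-monoˡ-≤ _ (*-monoʳ-≤ (length L) (*-mono-≤ (binom-mono aq≤k (≤-refl {t * q})) (binom-mono bq≤j (≤-refl {f * q})))) ⟩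
      length L * (binom k (t * q) * binom j (f * q)) * (a ^ k * (b ^ j * g ^ c))
        ≤⟨ first-moment 2≤n a b g k j c (t * q) (f * q) sum 2k+tq≤ (s≤s i+fq≤k) L uniq bad ⟩
      n * ((a + b + g) ^ n * (c ^ k * ((n ∸ k) ^ j * n ^ c)))
        ≡⟨ cong (λ x → n * (x ^ n * (c ^ k * ((n ∸ k) ^ j * n ^ c)))) (sym D-split) ⟩
      n * (D ^ n * (c ^ k * ((n ∸ k) ^ j * n ^ c))) ∎)
    where
    open ≤-Reasoning
    q = n / D
    -- j = i + 1 exceeds b n / D strictly, which gives D c ≤ g n. The added one is affordable
    -- because a heavy set has k + 1 free vertices, so i + f q ≤ k is enough.
    i = (b * n) / D
    j = suc i
    c = n ∸ (k + j)
    qD≤n : D * q ≤ n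
    qD≤n = ≤-trans (≤-reflexive (*-comm D q)) (m/n*n≤m n D)
    Di≤bn : D * i ≤ b * n
    Di≤bn = ≤-trans (≤-reflexive (*-comm D i)) (m/n*n≤m (b * n) D)
    below-next : ∀ m → m < D * (m / D) + D
    below-next m = begin-strict
      m                       ≡⟨ m≡m%n+[m/n]*n m D ⟩
      m % D + (m / D) * D     <⟨ +-monoˡ-< ((m / D) * D) (m%n<n m D) ⟩
      D + (m / D) * D         ≡⟨ trans (+-comm D _) (cong (_+ D) (*-comm (m / D) D)) ⟩
      D * (m / D) + D         ∎
    n< : n < D * q + D
    n< = below-next n
    bn<Dj : b * n < D * j
    bn<Dj = subst (b * n <_) (trans (+-comm (D * i) D) (sym (*-suc D i))) (below-next (b * n))
    scaled : ∀ x → D * (x * q) ≤ x * n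
    scaled x = ≤-trans (≤-reflexive (lem D x q)) (*-monoʳ-≤ x qD≤n)
      where
      lem : ∀ D x q → D * (x * q) ≡ x * (D * q)
      lem = solve-∀
    aq≤k : a * q ≤ k
    aq≤k = *-cancelˡ-≤ D (≤-trans (scaled a) an≤Dk)
    bq≤j : b * q ≤ j
    bq≤j = *-cancelˡ-≤ D (≤-trans (scaled b) (<⇒≤ bn<Dj))
    j≤ : j ≤ b * q + suc b
    j≤ = ≤-trans (s≤s (*-cancelˡ-≤ D (begin
      D * i                   ≤⟨ Di≤bn ⟩
      b * n                   ≤⟨ *-monoʳ-≤ b (<⇒≤ n<) ⟩
      b * (D * q + D)         ≡⟨ lem b D q ⟩
      D * (b * q + b)         ∎))) (≤-reflexive (sym (+-suc (b * q) b)))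
      where
      lem : ∀ b D q → b * (D * q + D) ≡ D * (b * q + b)
      lem = solve-∀
    i+fq≤k : i + f * q ≤ k
    i+fq≤k = *-cancelˡ-≤ D (begin
      D * (i + f * q)         ≡⟨ *-distribˡ-+ D i (f * q) ⟩
      D * i + D * (f * q)     ≤⟨ +-mono-≤ Di≤bn (scaled f) ⟩
      b * n + f * n           ≡⟨ *-distribʳ-+ n b f ⟨
      (b + f) * n             ≡⟨ cong (_* n) (sym a-split) ⟩
      a * n                   ≤⟨ an≤Dk ⟩
      D * k                   ∎)
    k+j≤n : k + j ≤ n
    k+j≤n = begin
      k + j                   ≤⟨ +-monoʳ-≤ k (s≤s (≤-trans (m≤m+n i (f * q)) i+fq≤k)) ⟩
      k + suc k               ≡⟨ lem k ⟩
      suc (2 * k)             ≤⟨ 2k<n ⟩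
      n                       ∎
      where
      lem : ∀ k → k + suc k ≡ suc (2 * k)
      lem = solve-∀
    sum : k + (j + c) ≡ n
    sum = trans (sym (+-assoc k j c)) (m+[n∸m]≡n k+j≤n)
    2k+tq≤ : 2 * k + t * q ≤ suc n
    2k+tq≤ = ≤-trans (*-cancelˡ-≤ D (begin
      D * (2 * k + t * q)       ≡⟨ lem D k (t * q) ⟩
      2 * (D * k) + D * (t * q) ≤⟨ +-mono-≤ (*-monoʳ-≤ 2 Dk≤hn) (scaled t) ⟩
      2 * (h * n) + t * n       ≡⟨ lem′ h n t ⟩
      (2 * h + t) * n           ≡⟨ cong (_* n) h-split ⟨
      D * n                     ∎)) (n≤1+n n)
      where
      lem : ∀ D k x → D * (2 * k + x) ≡ 2 * (D * k) + D * x
      lem = solve-∀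
      lem′ : ∀ h n t → 2 * (h * n) + t * n ≡ (2 * h + t) * n
      lem′ = solve-∀
    Dn≡ : D * n ≡ a * n + (b * n + g * n)
    Dn≡ = trans (cong (_* n) D-split) (lem a b g n)
      where
      lem : ∀ a b g n → (a + b + g) * n ≡ a * n + (b * n + g * n)
      lem = solve-∀
    Dc≤ : D * c ≤ g * n
    Dc≤ = +-cancelˡ-≤ (a * n + b * n) _ _ (begin
      a * n + b * n + D * c       ≤⟨ +-monoˡ-≤ (D * c) (+-mono-≤ an≤Dk (<⇒≤ bn<Dj)) ⟩
      D * k + D * j + D * c       ≡⟨ lem D k j c ⟩
      D * (k + (j + c))           ≡⟨ cong (D *_) sum ⟩
      D * n                       ≡⟨ trans Dn≡ (sym (+-assoc (a * n) _ _)) ⟩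
      a * n + b * n + g * n       ∎)
      where
      lem : ∀ D k j c → D * k + D * j + D * c ≡ D * (k + (j + c))
      lem = solve-∀
    Dn-k≤ : D * (n ∸ k) ≤ e * n
    Dn-k≤ = +-cancelˡ-≤ (a * n) _ _ (begin
      a * n + D * (n ∸ k)         ≤⟨ +-monoˡ-≤ _ an≤Dk ⟩
      D * k + D * (n ∸ k)         ≡⟨ *-distribˡ-+ D k (n ∸ k) ⟨
      D * (k + (n ∸ k))           ≡⟨ cong (D *_) (m+[n∸m]≡n (≤-trans (m≤m+n k j) k+j≤n)) ⟩
      D * n                       ≡⟨ trans Dn≡ (cong (a * n +_) (sym (*-distribʳ-+ n b g))) ⟩
      a * n + e * n               ∎)

  cell-bound : ∀ m → ∃ λ N → ∀ n → N ≤ n → ∀ k → a * n ≤ D * k → D * k ≤ h * n → 2 * k < n →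
    (L : List (Adj n)) → Unique L → All (Ascent k) L → m * (n * length L) ≤ n ^ (n ∸ 2)
  -- This makes n / D larger than q₀, hence positive, and n at least 2.
  cell-bound m = suc q₀ * D + 2 , bound
    where
    open ≤-Reasoning
    threshold : ∃ λ q₀ → ∀ q → q₀ ≤ q → m * K * (suc (a + t) * suc a * D ^ 4) * (suc q ^ 6 * U₀ ^ q) ≤ V₀ ^ q
    -- The exponent 6 collects two linear factors from the entropy bounds and four factors n: one
    -- from `first-moment`, two from n^n against n^(n-2), and one reserved for the later sum over k.
    threshold = exp-beats-poly U₀ V₀ 1≤U₀ U₀<V₀ 6 (m * K * (suc (a + t) * suc a * D ^ 4))
    q₀ = proj₁ threshold
    bound : ∀ n → suc q₀ * D + 2 ≤ n → ∀ k → a * n ≤ D * k → D * k ≤ h * n → 2 * k < n →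
      (L : List (Adj n)) → Unique L → All (Ascent k) L → m * (n * length L) ≤ n ^ (n ∸ 2)
    bound n N≤n k an≤Dk Dk≤hn 2k<n L uniq bad =
      *-cancelʳ-≤ _ _ (V₀ ^ q) {{>-nonZero (1≤^ V₀ q (≤-trans 1≤U₀ (<⇒≤ U₀<V₀)))}} (begin
        m * (n * length L) * V₀ ^ q
          ≡⟨ lem m n (length L) (V₀ ^ q) ⟩
        m * n * (length L * V₀ ^ q)
          ≤⟨ *-monoʳ-≤ (m * n) (cell-rate n k 2≤n 1≤q an≤Dk Dk≤hn 2k<n L uniq bad) ⟩
        m * n * (suc ((a + t) * q) * suc (a * q) * (n * n ^ n * K) * U₀ ^ q)
          ≡⟨ cong (λ x → m * n * (suc ((a + t) * q) * suc (a * q) * (n * x * K) * U₀ ^ q)) n^n≡ ⟩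
        m * n * (suc ((a + t) * q) * suc (a * q) * (n * (n * n * n ^ (n ∸ 2)) * K) * U₀ ^ q)
          ≡⟨ lem′ m n (suc ((a + t) * q)) (suc (a * q)) K (n ^ (n ∸ 2)) (U₀ ^ q) ⟩
        n ^ (n ∸ 2) * (m * K * (suc ((a + t) * q) * suc (a * q) * (n * (n * (n * (n * 1))))) * U₀ ^ q)
          ≤⟨ *-monoʳ-≤ (n ^ (n ∸ 2)) (*-monoˡ-≤ (U₀ ^ q) (*-monoʳ-≤ (m * K)
               (*-mono-≤ (*-mono-≤ (linear (a + t)) (linear a)) (^-monoˡ-≤ 4 n≤)))) ⟩
        n ^ (n ∸ 2) * (m * K * (suc (a + t) * suc q * (suc a * suc q) * (D * suc q) ^ 4) * U₀ ^ q)
          ≡⟨ cong (λ x → n ^ (n ∸ 2) * (m * K * (suc (a + t) * suc q * (suc a * suc q) * x) * U₀ ^ q)) (^-distribʳ-* 4 D (suc q)) ⟩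
        n ^ (n ∸ 2) * (m * K * (suc (a + t) * suc q * (suc a * suc q) * (D ^ 4 * suc q ^ 4)) * U₀ ^ q)
          ≡⟨ collect (n ^ (n ∸ 2)) (m * K) (suc (a + t)) (suc q) (suc a) (D ^ 4) (U₀ ^ q) ⟩
        n ^ (n ∸ 2) * (m * K * (suc (a + t) * suc a * D ^ 4) * (suc q ^ 6 * U₀ ^ q))
          ≤⟨ *-monoʳ-≤ (n ^ (n ∸ 2)) (proj₂ threshold q (≤-trans (n≤1+n q₀) q₀<q)) ⟩
        n ^ (n ∸ 2) * V₀ ^ q ∎)
      where
      q = n / D
      2≤n : 2 ≤ n
      2≤n = ≤-trans (m≤n+m 2 (suc q₀ * D)) N≤n
      q₀<q : suc q₀ ≤ q
      q₀<q = ≤-trans (≤-reflexive (sym (m*n/n≡m (suc q₀) D))) (/-monoˡ-≤ D (≤-trans (m≤m+n (suc q₀ * D) 2) N≤n))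
      1≤q : 1 ≤ q
      1≤q = ≤-trans (s≤s z≤n) q₀<q
      n≤ : n ≤ D * suc q
      n≤ = begin
        n                   ≡⟨ m≡m%n+[m/n]*n n D ⟩
        n % D + q * D       ≤⟨ +-monoˡ-≤ (q * D) (<⇒≤ (m%n<n n D)) ⟩
        D + q * D           ≡⟨ *-comm (suc q) D ⟩
        D * suc q           ∎
      linear : ∀ x → suc (x * q) ≤ suc x * suc q
      linear x = ≤-trans (m≤m+n (suc (x * q)) (q + x)) (≤-reflexive (lem₀ x q))
        where
        lem₀ : ∀ x q → suc (x * q) + (q + x) ≡ suc x * suc q
        lem₀ = solve-∀
      n^n≡ : n ^ n ≡ n * n * n ^ (n ∸ 2)
      n^n≡ = trans (cong (n ^_) (sym (m+[n∸m]≡n 2≤n))) (sym (*-assoc n n _))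
      lem : ∀ m n l v → m * (n * l) * v ≡ m * n * (l * v)
      lem = solve-∀
      lem′ : ∀ m n x y K N u → m * n * (x * y * (n * (n * n * N) * K) * u) ≡ N * (m * K * (x * y * (n * (n * (n * (n * 1))))) * u)
      lem′ = solve-∀

-- Covering the range of k/n by cells

data Cover (D : ℕ) : ℕ → Set where
  end  : ∀ {a} → 1 ≤ a → D ≤ 2 * a → Cover D a
  cons : ∀ {a} h → Cell D a h → Cover D h → Cover D a

cover-bound : ∀ {D a} → Cover D a → ∀ m → ∃ λ N → ∀ n → N ≤ n → ∀ k → a * n ≤ D * k → 2 * k < n →
  (L : List (Adj n)) → Unique L → All (Ascent k) L → m * (n * length L) ≤ n ^ (n ∸ 2)
cover-bound {D} {a} (end 1≤a D≤2a) m = 0 , λ n _ k an≤Dk 2k<n → ⊥-elim (<⇒≱ 2k<n (n≤2k n k an≤Dk))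
  where
  open ≤-Reasoning
  n≤2k : ∀ n k → a * n ≤ D * k → n ≤ 2 * k
  n≤2k n k an≤Dk = *-cancelˡ-≤ a {{>-nonZero 1≤a}} (begin
    a * n          ≤⟨ an≤Dk ⟩
    D * k          ≤⟨ *-monoˡ-≤ k D≤2a ⟩
    2 * a * k      ≡⟨ lem a k ⟩
    a * (2 * k)    ∎)
    where
    lem : ∀ a k → 2 * a * k ≡ a * (2 * k)
    lem = solve-∀
cover-bound {D} {a} (cons h C Cs) m = N ⊔ N′ , both
  where
  N N′ : ℕ
  N  = proj₁ (cell-bound C m)
  N′ = proj₁ (cover-bound Cs m)
  both : ∀ n → N ⊔ N′ ≤ n → ∀ k → a * n ≤ D * k → 2 * k < n →
    (L : List (Adj n)) → Unique L → All (Ascent k) L → m * (n * length L) ≤ n ^ (n ∸ 2)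
  both n N≤ k an≤Dk 2k<n L uniq all = go (≤-total (D * k) (h * n))
    where
    go : D * k ≤ h * n ⊎ h * n ≤ D * k → m * (n * length L) ≤ n ^ (n ∸ 2)
    go (inj₁ Dk≤hn) = proj₂ (cell-bound C m) n (≤-trans (m≤m⊔n N N′) N≤) k an≤Dk Dk≤hn 2k<n L uniq all
    go (inj₂ hn≤Dk) = proj₂ (cover-bound Cs m) n (≤-trans (m≤n⊔m N N′) N≤) k hn≤Dk 2k<n L uniq all

opaque
  unfolding Separated
  sep₁ : Separated 50000 17334 10900 6434 21766 15330
  sep₁ = tt
  sep₂ : Separated 50000 17335 11000 6335 21665 15326
  sep₂ = tt
  sep₃ : Separated 50000 17337 11000 6337 21663 15318
  sep₃ = tt
  sep₄ : Separated 50000 17341 11000 6341 21659 15300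
  sep₄ = tt
  sep₅ : Separated 50000 17350 11000 6350 21650 15260
  sep₅ = tt
  sep₆ : Separated 50000 17370 11000 6370 21630 15170
  sep₆ = tt
  sep₇ : Separated 50000 17415 11300 6115 21285 14968
  sep₇ = tt
  sep₈ : Separated 50000 17516 11700 5816 20784 14510
  sep₈ = tt
  sep₉ : Separated 50000 17745 12500 5245 19755 13450
  sep₉ = tt
  sep₁₀ : Separated 50000 18275 14500 3775 17225 10940
  sep₁₀ = tt
  sep₁₁ : Separated 50000 19530 18000 1530 12470 5166
  sep₁₁ = tt
  sep₁₂ : Separated 50000 22417 22000 417 5583 0
  sep₁₂ = tt

-- For numerals each implicit argument has a type that evaluates to the unit type, so it is filled
-- in automatically.
cell : ∀ {D a h} b f g t → {T (a ≡ᵇ b + f)} → {T (D ≡ᵇ a + b + g)} → {T (D ≡ᵇ 2 * h + t)} →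
  {T (1 ≤ᵇ b)} → {T (1 ≤ᵇ g)} → {T (g * g ≤ᵇ a * D)} → Separated D a b f g t → Cell D a h
cell b f g t {a≡} {D≡} {h≡} {1≤b} {1≤g} {g²≤} sep = record
  { a-split = ≡ᵇ⇒≡ _ _ a≡; D-split = ≡ᵇ⇒≡ _ _ D≡; h-split = ≡ᵇ⇒≡ _ _ h≡
  ; b-pos = ≤ᵇ⇒≤ _ _ 1≤b; g-pos = ≤ᵇ⇒≤ _ _ 1≤g; g²≤aD = ≤ᵇ⇒≤ _ _ g²≤; separated = sep }

-- In each cell b roughly minimises upper/lower at the left end, and h is almost as large as upper < lower then allows;
-- the first cells are short because at k/n = 0.34668 the ratio is only e^(-3.7/100000) per vertex.
cover : Cover 50000 17334
cover =
  cons 17335 (cell 10900 6434 21766 15330 sep₁) (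
  cons 17337 (cell 11000 6335 21665 15326 sep₂) (
  cons 17341 (cell 11000 6337 21663 15318 sep₃) (
  cons 17350 (cell 11000 6341 21659 15300 sep₄) (
  cons 17370 (cell 11000 6350 21650 15260 sep₅) (
  cons 17415 (cell 11000 6370 21630 15170 sep₆) (
  cons 17516 (cell 11300 6115 21285 14968 sep₇) (
  cons 17745 (cell 11700 5816 20784 14510 sep₈) (
  cons 18275 (cell 12500 5245 19755 13450 sep₉) (
  cons 19530 (cell 14500 3775 17225 10940 sep₁₀) (
  cons 22417 (cell 18000 1530 12470 5166 sep₁₁) (
  -- The right end is one half, so t = 0 and the path bound degenerates to X_k ≥ 1, which still
  -- suffices here.
  cons 25000 (cell 22000 417 5583 0 sep₁₂) (
  end (≤ᵇ⇒≤ _ _ tt) (≤ᵇ⇒≤ _ _ tt)))))))))))))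

-- Union over all set sizes

∑-∈ : {B : Set} {xs : List B} (f : B → ℕ) {x : B} → x List.∈ xs → f x ≤ ∑ xs f
∑-∈ {xs = x ∷ xs} f (here refl) = m≤m+n (f x) (∑ xs f)
∑-∈ {xs = x ∷ xs} f (there m)   = ≤-trans (∑-∈ f m) (m≤n+m _ (f x))

length-≤-∑-filter : ∀ {B : Set} {P : ℕ → B → Set} (P? : ∀ k x → Dec (P k x)) n (xs : List B) →
  All (λ x → ∃ λ k → k < n × P k x) xs → length xs ≤ ∑ (upTo n) (λ k → length (filter (P? k) xs))
length-≤-∑-filter P? n xs all = begin
  length xs                                        ≤⟨ count xs all ⟩
  ∑ xs (λ x → ∑ (upTo n) (λ k → 𝟙 (P? k x)))       ≡⟨ ∑-swap xs (upTo n) _ ⟩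
  ∑ (upTo n) (λ k → ∑ xs (λ x → 𝟙 (P? k x)))       ≡⟨ ∑-cong (upTo n) (λ k → length-filter≡∑ (P? k) xs) ⟨
  ∑ (upTo n) (λ k → length (filter (P? k) xs))     ∎
  where
  open ≤-Reasoning
  count : ∀ xs → All _ xs → length xs ≤ ∑ xs (λ x → ∑ (upTo n) (λ k → 𝟙 (P? k x)))
  count []       []                   = z≤n
  count (x ∷ xs) ((k , k<n , p) ∷ ps) = +-mono-≤
    (≤-trans (𝟙-yes (P? k x) p) (∑-∈ (λ k → 𝟙 (P? k x)) (∈-upTo⁺ k<n))) (count xs ps)

Violation : ∀ {n} → ℕ → ℕ → Adj n → ℕ → Set
Violation {n} D a A k = a * n ≤ D * k × X A k < X A (suc k)

Violation? : ∀ {n} D a (A : Adj n) k → Dec (Violation D a A k)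
Violation? {n} D a A k = (a * n ≤? D * k) ×-dec (X A k <? X A (suc k))

violation : ∀ {n} D a (A : Adj n) → ¬ (∀ k → a * n ≤ D * k → suc k ≤ n → X A (suc k) ≤ X A k) →
  ∃ λ k → k < n × Violation D a A k
violation {n} D a A ¬dec = decidable-stable (anyUpTo? (Violation? D a A) n)
  λ none → ¬dec λ k an≤Dk k<n → ≮⇒≥ λ X< → none (k , k<n , an≤Dk , X<)

-- Every exceptional tree has an ascent at some k < n. Summing over the n possible values of k is
-- paid for by the extra factor n in `cover-bound`.
covered-tail : ∀ {D a} → Cover D a → (m : ℕ) → ∃ λ N → ∀ n → N ≤ n → (bad : List (Adj n)) → Unique bad →
  All (λ A → IsTree A × ¬ (∀ k → a * n ≤ D * k → suc k ≤ n → X A (suc k) ≤ X A k)) bad →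
  m * length bad ≤ n ^ (n ∸ 2)
covered-tail {D} {a} Cs m = suc N , bound
  where
  open ≤-Reasoning
  N : ℕ
  N = proj₁ (cover-bound Cs m)
  lem : ∀ n m l → n * (m * l) ≡ l * (m * n)
  lem = solve-∀
  lem′ : ∀ l m n → l * (m * n) ≡ m * (n * l)
  lem′ = solve-∀
  per-size : ∀ {n k} (L : List (Adj n)) → Unique L → All (λ A → IsTree A × Violation D a A k) L → N ≤ n →
    m * (n * length L) ≤ n ^ (n ∸ 2)
  -- The empty list is treated apart because 2k < n is deduced from an ascent in a member of the
  -- list.
  per-size {n} {k} [] _ _ _ = ≤-trans (≤-reflexive (trans (cong (m *_) (*-zeroʳ n)) (*-zeroʳ m))) z≤n
  per-size {n} {k} (A ∷ L) uniq all@((_ , an≤Dk , X<) ∷ _) N≤n =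
    proj₂ (cover-bound Cs m) n N≤n k an≤Dk (ascent-below-half A k X<) (A ∷ L) uniq (All.map (λ (tree , _ , X<) → tree , X<) all)
  bound : ∀ n → suc N ≤ n → (bad : List (Adj n)) → Unique bad →
    All (λ A → IsTree A × ¬ (∀ k → a * n ≤ D * k → suc k ≤ n → X A (suc k) ≤ X A k)) bad →
    m * length bad ≤ n ^ (n ∸ 2)
  bound n N<n bad uniq trees = *-cancelˡ-≤ n {{>-nonZero (≤-trans (s≤s z≤n) N<n)}} (begin
    n * (m * length bad)
      ≡⟨ lem n m (length bad) ⟩
    length bad * (m * n)
      ≤⟨ *-monoˡ-≤ (m * n) (length-≤-∑-filter (λ k A → V? A k) n bad (All.map (λ {A} (_ , ¬dec) → violation D a A ¬dec) trees)) ⟩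
    ∑ (upTo n) (λ k → length (at k)) * (m * n)
      ≡⟨ ∑-*ʳ (upTo n) _ (m * n) ⟨
    ∑ (upTo n) (λ k → length (at k) * (m * n))
      ≤⟨ ∑-mono (upTo n) (λ k → ≤-trans (≤-reflexive (lem′ (length (at k)) m n)) (at-bound k)) ⟩
    ∑ (upTo n) (λ _ → n ^ (n ∸ 2))
      ≡⟨ ∑-const (upTo n) _ ⟩
    length (upTo n) * n ^ (n ∸ 2)
      ≡⟨ cong (_* n ^ (n ∸ 2)) (length-upTo n) ⟩
    n * n ^ (n ∸ 2) ∎)
    where
    V? : ∀ A k → Dec (Violation D a A k)
    V? = Violation? D a
    at : ℕ → List (Adj n)
    at k = filter (λ A → V? A k) bad
    at-bound : ∀ k → m * (n * length (at k)) ≤ n ^ (n ∸ 2)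
    at-bound k = per-size (at k) (Unique.filter⁺ (λ A → V? A k) uniq)
      (All.zip (All.filter⁺ (λ A → V? A k) (All.map proj₁ trees) , All.all-filter (λ A → V? A k) bad))
      (≤-trans (n≤1+n N) N<n)

cancel-scale : ∀ c x y n k → 1 ≤ c → (c * x) * n ≤ (c * y) * k → x * n ≤ y * k
cancel-scale c x y n k 1≤c h = *-cancelˡ-≤ c {{>-nonZero 1≤c}}
  (≤-trans (≤-reflexive (sym (*-assoc c x n))) (≤-trans h (≤-reflexive (*-assoc c y k))))

theorem1p4 : (m : ℕ) → 1 ≤ m → Σ ℕ λ N → (n : ℕ) → N ≤ n →
    (bad : List (Adj n)) → Unique bad →
    All (λ T → IsTree T × ¬ TailDecreasing T) bad →
    m * length bad ≤ n ^ (n ∸ 2)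
theorem1p4 m _ = proj₁ (covered-tail cover m) , λ n N≤n bad uniq trees →
  proj₂ (covered-tail cover m) n N≤n bad uniq
    -- 34668/100000 is 17334/50000 after cancelling 2.
    (All.map (λ (tree , ¬dec) → tree , λ dec → ¬dec λ k kn → dec k (cancel-scale 2 17334 50000 n k (s≤s z≤n) kn)) trees)
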